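{- Let $F$ be any forest on the vertex set $[n+1]$ with $l\ge 1$ edges. If $\mathcal{T}_F^{\mathcal{S}}$ is an $\mathcal{S}$-reduction tree with root labeled $F$, then the number of leaves of $\mathcal{T}_F^{\mathcal{S}}$ labeled by forests with $k$ edges, denoted by $f_{F,k}$, is a function of $F$ and $k$ only. In other words, if $P_n^{\mathcal{S}}$ is a reduced form of $m^{\mathcal{S}}[F]$, then $$P_n^{\mathcal{S}}(x_{ij}=1)=\sum_{m=0}^{l-1}f_{F,l-m}\,\beta^m.$$
   Context: Graphs have vertex set $[n+1]=\{1,\ldots,n+1\}$; an edge joining $i<j$ is written $(i,j)$. Reduction rule for graphs: given $G_0$ with $(i,j),(j,k)\in E(G_0)$, $i<j<k$, $G_0$ reduces to $G_1,G_2,G_3$ with $E(G_1)=E(G_0)\setminus\{(j,k)\}\cup\{(i,k)\}$, $E(G_2)=E(G_0)\setminus\{(i,j)\}\cup\{(i,k)\}$, $E(G_3)=E(G_0)\setminus\{(i,j)\}\setminus\{(j,k)\}\cup\{(i,k)\}$. An $\mathcal{S}$-reduction tree with root labeled $F$ is a rooted tree with nodes labeled by graphs, with root labeled $F$, in which every node whose label admits a reduction has three children labeled by the graphs $G_1,G_2,G_3$ resulting from one chosen reduction of it (for some choice of pair of edges), and whose leaves are labeled by graphs to which no reduction can be applied. $m^{\mathcal{S}}[F]=\prod_{(i,j)\in E(F)}x_{ij}$ in commuting variables $x_{ij}$, $1\le i<j\le n+1$. The reduction rule for monomials is $x_{ij}x_{jk}\to x_{ik}x_{ij}+x_{jk}x_{ik}+\beta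 x_{ik}$ for $i<j<k$ ($\beta$ a further variable), applied in one monomial of a polynomial at a time; a reduced form of a monomial is a polynomial obtained by successive applications of the rule until no monomial is divisible by any $x_{ij}x_{jk}$, $i<j<k$. -}

module Defs where

open import Data.Bool using (Bool; true; false; if_then_else_)
import Data.Bool.Properties as Bool
open import Data.Empty using (⊥)
open import Data.Fin using (Fin; zero; suc; _<_)
open import Data.Fin.Properties using (any?; _<?_; injective⇒≤)
import Data.Fin.Properties as Fin
open import Data.Fin.Subset using (∣_∣)
open import Data.List using (List; []; _∷_; _++_; _∷ʳ_; length; map; concat; replicate; applyUpTo; filter; lookup)
open import Data.List.Membership.Propositional.Properties using (∈-lookup)
open import Data.List.Relation.Unary.All using (All)
import Data.List.Relation.Unary.All as All
open import Data.List.Relation.Unary.AllPairs using (_∷_)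
open import Data.List.Relation.Unary.Linked using (Linked; linked?)
open import Data.List.Relation.Unary.Unique.Propositional using (Unique)
open import Data.List.Relation.Unary.Unique.DecPropositional using (unique?)
open import Data.List.Relation.Binary.Permutation.Propositional using (_↭_)
open import Data.Nat using (ℕ; zero; suc; _+_; _∸_; _≤_; s≤s; _≤?_; _≟_)
import Data.Nat as ℕ
open import Data.Product using (∃-syntax; Σ-syntax; _×_; _,_)
open import Data.Sum using (_⊎_; inj₁; inj₂)
open import Data.Vec using (Vec; []; _∷_)
import Data.Vec as Vec
open import Function using (_∘_)
open import Function.Definitions using (Injective)
open import Relation.Binary using (Decidable)
open import Relation.Binary.Construct.Closure.ReflexiveTransitive using (Star)
open import Relation.Binary.PropositionalEquality using (_≡_; refl; sym; cong)
open import Relation.Nullary using (¬_; Dec; yes; no; _×-dec_; _⊎-dec_; contradiction)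
open import Relation.Nullary.Decidable using (map′)
import Relation.Unary as U

-- The vertices 1 , … , N are the elements of Fin N, in the same order.

record Pair (N : ℕ) : Set where
  constructor pair
  field
    lo hi  : Fin N
    .lo<hi : lo < hi

-- Strictly upper triangular arrays: the head row holds the entries at
-- (zero , j) for j > zero.

data Table (A : Set) : ℕ → Set where
  []  : Table A zero
  _∷_ : ∀ {N} → Vec A N → Table A N → Table A (suc N)

at : ∀ {A N} → Table A N → Pair N → A
at (row ∷ t) (pair zero    (suc j) _) = Vec.lookup row j
at (row ∷ t) (pair (suc i) (suc j) p) = at t (pair i j (ℕ.s≤s⁻¹ p))

infixl 6 _[_]≔_

_[_]≔_ : ∀ {A N} → Table A N → Pair N → A → Table A N
(row ∷ t) [ pair zero    (suc j) _ ]≔ a = (row Vec.[ j ]≔ a) ∷ t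
(row ∷ t) [ pair (suc i) (suc j) p ]≔ a = row ∷ (t [ pair i j (ℕ.s≤s⁻¹ p) ]≔ a)

constant : ∀ {A} N → A → Table A N
constant zero    a = []
constant (suc N) a = Vec.replicate N a ∷ constant N a

mapTable : ∀ {A B N} → (A → B) → Table A N → Table B N
mapTable f []        = []
mapTable f (row ∷ t) = Vec.map f row ∷ mapTable f t

zipTable : ∀ {A B C N} → (A → B → C) → Table A N → Table B N → Table C N
zipTable f []        []         = []
zipTable f (row ∷ t) (row′ ∷ u) = Vec.zipWith f row row′ ∷ zipTable f t u

-- A (simple) graph on N vertices is the indicator of its edge set.

Graph : ℕ → Set
Graph N = Table Bool N

infix 4 _∈ᴱ_

_∈ᴱ_ : ∀ {N} → Pair N → Graph N → Set
e ∈ᴱ G = at G e ≡ true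

infixl 6 _∪_ _∖_

_∪_ _∖_ : ∀ {N} → Graph N → Pair N → Graph N
G ∪ e = G [ e ]≔ true
G ∖ e = G [ e ]≔ false

edgeCount : ∀ {N} → Graph N → ℕ
edgeCount []        = 0
edgeCount (row ∷ G) = ∣ row ∣ + edgeCount G

Adjacent : ∀ {N} → Graph N → Fin N → Fin N → Set
Adjacent G u v = (Σ[ p ∈ u < v ] pair u v p ∈ᴱ G) ⊎ (Σ[ p ∈ v < u ] pair v u p ∈ᴱ G)

-- The list v ∷ vs of distinct vertices is a cycle if it has at least three
-- elements and consecutive vertices of v ∷ vs ∷ʳ v are adjacent.

IsCycle : ∀ {N} → Graph N → List (Fin N) → Set
IsCycle G []       = ⊥
IsCycle G (v ∷ vs) = 3 ≤ length (v ∷ vs) × Unique (v ∷ vs) × Linked (Adjacent G) (v ∷ vs ∷ʳ v)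

IsForest : ∀ {N} → Graph N → Set
IsForest G = ∀ vs → ¬ IsCycle G vs

adjacent? : ∀ {N} (G : Graph N) → Decidable (Adjacent G)
adjacent? G u v = oriented? u v ⊎-dec oriented? v u
  where
  oriented? : ∀ a b → Dec (Σ[ p ∈ a < b ] pair a b p ∈ᴱ G)
  oriented? a b with a <? b
  ... | yes p   = map′ (p ,_) (λ (_ , e) → e) (at G (pair a b p) Bool.≟ true)
  ... | no  a≮b = no λ (p , _) → a≮b p

isCycle? : ∀ {N} (G : Graph N) → U.Decidable (IsCycle G)
isCycle? G []       = no λ ()
isCycle? G (v ∷ vs) =
  3 ≤? length (v ∷ vs) ×-dec unique? Fin._≟_ (v ∷ vs) ×-dec linked? (adjacent? G) (v ∷ vs ∷ʳ v)

lookup-injective : ∀ {A : Set} {xs : List A} → Unique xs → Injective _≡_ _≡_ (lookup xs)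
lookup-injective (_ ∷ _)  {zero}  {zero}  _  = refl
lookup-injective (px ∷ _) {zero}  {suc j} eq = contradiction eq (All.lookup px (∈-lookup j))
lookup-injective (px ∷ _) {suc i} {zero}  eq = contradiction (sym eq) (All.lookup px (∈-lookup i))
lookup-injective (_ ∷ u)  {suc i} {suc j} eq = cong suc (lookup-injective u eq)

-- A list of distinct vertices has at most N elements, so it suffices to
-- search the lists of length at most N.

forest? : ∀ {N} → U.Decidable (IsForest {N})
forest? {N} G with bounded? N (isCycle? G)
  where
  bounded? : ∀ b {P : List (Fin N) → Set} → U.Decidable P → Dec (∃[ vs ] length vs ≤ b × P vs)
  bounded? zero    P? = map′ (λ p → [] , ℕ.z≤n , p) (λ { ([] , _ , p) → p }) (P? [])
  bounded? (suc b) P? = map′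
    (λ { (inj₁ p)                → [] , ℕ.z≤n , p
       ; (inj₂ (v , vs , le , p)) → v ∷ vs , s≤s le , p })
    (λ { ([]     , _      , p) → inj₁ p
       ; (v ∷ vs , s≤s le , p) → inj₂ (v , vs , le , p) })
    (P? [] ⊎-dec any? (λ v → bounded? b (P? ∘ (v ∷_))))
... | yes (vs , _ , c) = no λ acyclic → acyclic vs c
... | no  none         = yes λ vs c → none (vs , short vs c , c)
  where
  short : ∀ vs → IsCycle G vs → length vs ≤ N
  short (v ∷ vs) (_ , unique , _) = injective⇒≤ (lookup-injective unique)

module _ {N : ℕ} {i j k : Fin N} (i<j : i < j) (j<k : j < k) where

  private
    ij = pair i j i<j
    jk = pair j k j<k
    ik = pair i k (Fin.<-trans i<j j<k)

  reduct₁ reduct₂ reduct₃ : Graph N → Graph N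
  reduct₁ G = G ∖ jk ∪ ik
  reduct₂ G = G ∖ ij ∪ ik
  reduct₃ G = G ∖ ij ∖ jk ∪ ik

record Reduction {N : ℕ} (G : Graph N) : Set where
  field
    {i j k} : Fin N
    i<j     : i < j
    j<k     : j < k
    ij∈G    : pair i j i<j ∈ᴱ G
    jk∈G    : pair j k j<k ∈ᴱ G

data ReductionTree {N : ℕ} (G : Graph N) : Set where
  leaf : ¬ Reduction G → ReductionTree G
  node : (r : Reduction G) → let open Reduction r in
         ReductionTree (reduct₁ i<j j<k G) →
         ReductionTree (reduct₂ i<j j<k G) →
         ReductionTree (reduct₃ i<j j<k G) →
         ReductionTree G

leafLabels : ∀ {N} {G : Graph N} → ReductionTree G → List (Graph N)
leafLabels {G = G} (leaf _)     = G ∷ []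
leafLabels (node _ T₁ T₂ T₃) = leafLabels T₁ ++ leafLabels T₂ ++ leafLabels T₃

forestLeafCount : ∀ {N} {G : Graph N} → ReductionTree G → ℕ → ℕ
forestLeafCount T k = length (filter (λ H → forest? H ×-dec edgeCount H ≟ k) (leafLabels T))

-- Monomials in β and the variables xᵢⱼ with i < j, given by their exponents.

record Monomial (N : ℕ) : Set where
  constructor monomial
  field
    xExponents : Table ℕ N
    βExponent  : ℕ

open Monomial public

infixl 7 _·_

_·_ : ∀ {N} → Monomial N → Monomial N → Monomial N
monomial a c · monomial b d = monomial (zipTable _+_ a b) (c + d)

x : ∀ {N} {i j : Fin N} → i < j → Monomial N
x {N} {i} {j} i<j = monomial (constant N 0 [ pair i j i<j ]≔ 1) 0

β^ : ∀ {N} → ℕ → Monomial N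
β^ m = monomial (constant _ 0) m

infix 4 _∣_

_∣_ : ∀ {N} → Monomial N → Monomial N → Set
m ∣ m′ = ∃[ q ] m′ ≡ m · q

-- The reduction rule has nonnegative coefficients, so all polynomials that
-- occur have coefficients in ℕ.  ℕ[β , xᵢⱼ] is the free commutative monoid
-- on the monomials: a polynomial is a list of monomials, the coefficient of
-- a monomial is its multiplicity, addition is _++_, and two lists are the
-- same polynomial when they are permutations of each other.

Polynomial : ℕ → Set
Polynomial N = List (Monomial N)

infix 4 _≈_

_≈_ : ∀ {N} → Polynomial N → Polynomial N → Set
_≈_ = _↭_

infixr 7 _⊙_

_⊙_ : ∀ {N} → ℕ → Monomial N → Polynomial N
c ⊙ m = replicate c m

∑< : ∀ {N} → ℕ → (ℕ → Polynomial N) → Polynomial N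
∑< l p = concat (applyUpTo p l)

-- The substitution xᵢⱼ = 1 for all i < j; the result involves β only.

_∣x=1 : ∀ {N} → Polynomial N → Polynomial N
P ∣x=1 = map (β^ ∘ βExponent) P

-- One application of the rule xᵢⱼ xⱼₖ → xᵢₖ xᵢⱼ + xⱼₖ xᵢₖ + β xᵢₖ, to one
-- occurrence of a monomial xᵢⱼ xⱼₖ m; a monomial with coefficient c is
-- rewritten as a whole by c steps.

data _⟶_ {N : ℕ} (P P′ : Polynomial N) : Set where
  rewrite-monomial :
    ∀ {i j k : Fin N} (i<j : i < j) (j<k : j < k) (m : Monomial N) (Q : Polynomial N) →
    let xij = x i<j
        xjk = x j<k
        xik = x {i = i} {j = k} (Fin.<-trans i<j j<k)
    in
    P  ≈ (xij · xjk · m) ∷ Q →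
    P′ ≈ map (_· m) (xik · xij ∷ xjk · xik ∷ β^ 1 · xik ∷ []) ++ Q →
    P ⟶ P′

Reduced : ∀ {N} → Polynomial N → Set
Reduced {N} P = ∀ {i j k : Fin N} (i<j : i < j) (j<k : j < k) →
                All (λ m → ¬ x i<j · x j<k ∣ m) P

_IsReducedFormOf_ : ∀ {N} → Polynomial N → Monomial N → Set
P IsReducedFormOf m = Star _⟶_ (m ∷ []) P × Reduced P

-- The product of the variables xᵢⱼ over the edges (i , j), that is,
-- exponent 1 on edges and 0 elsewhere.

graphMonomial : ∀ {N} → Graph N → Monomial N
graphMonomial G = monomial (mapTable (λ b → if b then 1 else 0) G) 0

module Submission where

-- Let every edge (i , j) of a multigraph carry a positive integral flow a, with
-- net flow a (eᵢ − eⱼ).  Given flows p on (i , j) and q on (j , k), the net flow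
-- is unchanged when min(p , q) is rerouted along (i , k); according to p > q,
-- p < q or p = q this leaves a positive flow on exactly one of the three reducts.
-- Hence ∑ h(net flow), summed over the positive flows, is additive under the
-- reduction rule for every function h.  When no reduction applies, every vertex
-- is a source or a sink, so the positive part of the net flow adds up to the
-- total flow s of the edges; choosing h = (−1)^(k − s) C(k − 1 , s − 1) makes the
-- sum equal to 1 if there are k edges and to 0 otherwise.  Adding up over the
-- leaves, or over the monomials of a reduced form, this sum for F counts those
-- with k edges.

open import Defs
open import Data.Nat using (ℕ; suc; _∸_; _≤_)
open import Data.Product using (Σ-syntax; _×_)
open import Relation.Binary.PropositionalEquality using (_≡_)

open import Algebra.Bundles using (CommutativeMonoid)
open import Algebra.Properties.CommutativeSemigroup using (interchange; x∙yz≈y∙xz)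
open import Data.Bool using (Bool; true; false; if_then_else_)
open import Data.Fin using (Fin; zero; suc; toℕ; _<_)
import Data.Fin.Properties as Fin
open import Data.Fin.Subset using (∣_∣)
open import Data.Integer using (ℤ; 0ℤ; _+_; _-_)
import Data.Integer.Base as ℤ
import Data.Integer.Properties as ℤ
open import Data.List using (List; []; _∷_; _++_; _∷ʳ_; length; map; replicate; filter)
import Data.List.Membership.DecPropositional as DecMembership
open import Data.List.Membership.Propositional using (_∈_)
open import Data.List.Membership.Propositional.Properties using (∈-++⁻; ∈-map⁻)
open import Data.List.Properties using (map-++; length-++; length-map; filter-++)
open import Data.List.Relation.Binary.Permutation.Propositional
  using (_↭_; ↭-sym; ↭-trans; ↭-refl; ↭-reflexive)
import Data.List.Relation.Binary.Permutation.Propositional as ↭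
open import Data.List.Relation.Binary.Permutation.Propositional.Properties
  using (map⁺; ++⁺; ++⁺ˡ; shift; ∈-resp-↭; All-resp-↭; ↭-length; ++-commutativeMonoid)
open import Data.List.Relation.Unary.All using (All; []; _∷_)
import Data.List.Relation.Unary.All as All
import Data.List.Relation.Unary.All.Properties as All
open import Data.List.Relation.Unary.AllPairs using ([]; _∷_)
open import Data.List.Relation.Unary.Any using (here; there)
open import Data.List.Relation.Unary.Linked using (Linked; [-]; _∷_)
open import Data.List.Relation.Unary.Unique.Propositional using (Unique)
open import Data.Nat using (zero; z≤n; s≤s)
import Data.Nat.Base as ℕ
open import Data.Nat.Induction using (<-rec)
import Data.Nat.Properties as ℕ
open import Data.Product using (∃-syntax; _,_; proj₁; proj₂)
open import Data.Sum using (_⊎_; inj₁; inj₂; [_,_]′)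
import Data.Sum as Sum
open import Data.Vec using (Vec; []; _∷_; lookup; updateAt)
import Data.Vec as Vec
open import Data.Vec.Properties
  using (updateAt-updateAt; updateAt-id-local; lookup∘updateAt; lookup∘updateAt′; lookup-replicate;
         lookup-map; lookup-zipWith; zipWith-identityˡ; zipWith-assoc; []≔-commutes; []≔-idempotent;
         []≔-lookup)
open import Function using (_∘_)
open import Function.Bundles using (mk⇔)
open import Relation.Binary.Construct.Closure.ReflexiveTransitive using (Star; ε; _◅_; _◅◅_)
import Relation.Binary.Construct.Closure.ReflexiveTransitive as Star
open import Relation.Binary.PropositionalEquality
  using (_≢_; _≗_; refl; sym; trans; cong; cong₂; subst; module ≡-Reasoning)
open import Relation.Nullary using (¬_; Dec; yes; no; contradiction; does; recompute; _×-dec_)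
open import Relation.Nullary.Decidable using (does-⇔)
open import Relation.Unary using (Decidable)
open Pair using (lo; hi)

private variable
  A : Set
  N : ℕ

-- Operators on counting functions

-- In terms of generating functions in t, this is multiplication by t^`d`.
delay : ℕ → (ℕ → ℤ) → ℕ → ℤ
delay zero    f b       = f b
delay (suc d) f zero    = 0ℤ
delay (suc d) f (suc b) = delay d f b

delay-local : ∀ d {f g} b → (∀ b′ → b′ ℕ.≤ b → f b′ ≡ g b′) → delay d f b ≡ delay d g b
delay-local zero    b       f≗g = f≗g b ℕ.≤-refl
delay-local (suc d) zero    f≗g = refl
delay-local (suc d) (suc b) f≗g = delay-local d b λ b′ le → f≗g b′ (ℕ.m≤n⇒m≤1+n le)

delay-cong : ∀ d {f g} b → f ≗ g → delay d f b ≡ delay d g b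
delay-cong d b f≗g = delay-local d b λ b′ _ → f≗g b′

-- A positive delay consults only strictly smaller arguments, which makes recursion on the budget
-- well founded.
delay-local-< : ∀ d {f g} b → 0 ℕ.< d → (∀ b′ → b′ ℕ.< b → f b′ ≡ g b′) → delay d f b ≡ delay d g b
delay-local-< (suc d) zero    _ f≗g = refl
delay-local-< (suc d) (suc b) _ f≗g = delay-local d b λ b′ le → f≗g b′ (s≤s le)

delay-delay : ∀ d e f b → delay d (delay e f) b ≡ delay (d ℕ.+ e) f b
delay-delay zero    e f b       = refl
delay-delay (suc d) e f zero    = refl
delay-delay (suc d) e f (suc b) = delay-delay d e f b

delay-+ : ∀ d f g b → delay d (λ b′ → f b′ + g b′) b ≡ delay d f b + delay d g b
delay-+ zero    f g b       = refl
delay-+ (suc d) f g zero    = refl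
delay-+ (suc d) f g (suc b) = delay-+ d f g b

delay-> : ∀ d f b → b ℕ.< d → delay d f b ≡ 0ℤ
delay-> (suc d) f zero    _         = refl
delay-> (suc d) f (suc b) (s≤s b<d) = delay-> d f b b<d

delay-≤ : ∀ d f b → d ℕ.≤ b → delay d f b ≡ f (b ∸ d)
delay-≤ zero    f b       _         = refl
delay-≤ (suc d) f (suc b) (s≤s d≤b) = delay-≤ d f b d≤b

-- Transport of one unit of flow along an edge

updateAt-comm : ∀ {f g : A → A} → f ∘ g ≗ g ∘ f → ∀ (v : Vec A N) i j →
                updateAt (updateAt v j g) i f ≡ updateAt (updateAt v i f) j g
updateAt-comm fg (x ∷ v) zero    zero    = cong (_∷ v) (fg x)
updateAt-comm fg (x ∷ v) zero    (suc j) = refl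
updateAt-comm fg (x ∷ v) (suc i) zero    = refl
updateAt-comm fg (x ∷ v) (suc i) (suc j) = cong (x ∷_) (updateAt-comm fg v i j)

-- The order proof inside a pair is irrelevant; deciding the order again makes it usable.
lo<hi : (e : Pair N) → lo e < hi e
lo<hi (pair i j i<j) = recompute (i Fin.<? j) i<j

span : Pair N → ℕ
span e = toℕ (hi e) ∸ toℕ (lo e)

0<span : (e : Pair N) → 0 ℕ.< span e
0<span e = ℕ.m<n⇒0<n∸m (lo<hi e)

span≤N : (e : Pair N) → span e ℕ.≤ N
span≤N (pair i j _) = ℕ.≤-trans (ℕ.m∸n≤m (toℕ j) (toℕ i)) (ℕ.<⇒≤ (Fin.toℕ<n j))

transport : Pair N → Vec ℤ N → Vec ℤ N
transport (pair i j _) v = updateAt (updateAt v j ℤ.pred) i ℤ.suc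

suc-pred-comm : ℤ.suc ∘ ℤ.pred ≗ ℤ.pred ∘ ℤ.suc
suc-pred-comm x = trans (ℤ.suc-pred x) (sym (ℤ.pred-suc x))

-- Transports are translations, so they commute even when the edges share vertices.
transport-comm : ∀ (e f : Pair N) v → transport e (transport f v) ≡ transport f (transport e v)
transport-comm (pair i j _) (pair k l _) v = begin
  up i (down j (up k (down l v))) ≡⟨ cong (up i) (down-up j k (down l v)) ⟩
  up i (up k (down j (down l v))) ≡⟨ updateAt-comm (λ _ → refl) (down j (down l v)) i k ⟩
  up k (up i (down j (down l v))) ≡⟨ cong (up k ∘ up i) (updateAt-comm (λ _ → refl) v j l) ⟩
  up k (up i (down l (down j v))) ≡⟨ cong (up k) (down-up l i (down j v)) ⟨
  up k (down l (up i (down j v))) ∎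
  where
  open ≡-Reasoning
  up down : Fin _ → Vec ℤ _ → Vec ℤ _
  up   i v = updateAt v i ℤ.suc
  down i v = updateAt v i ℤ.pred
  down-up : ∀ i j v → down i (up j v) ≡ up j (down i v)
  down-up i j v = sym (updateAt-comm suc-pred-comm v j i)

module _ {i j k : Fin N} (i<j : i < j) (j<k : j < k) where

  -- (eᵢ - eⱼ) + (eⱼ - eₖ) = eᵢ - eₖ: the two changes at j cancel. This is why rerouting along (i ,
  -- k) preserves the net flow.
  transport-trans : ∀ v → transport (pair j k j<k) (transport (pair i j i<j) v) ≡
                          transport (pair i k (Fin.<-trans i<j j<k)) v
  transport-trans v = begin
    updateAt (updateAt (updateAt (updateAt v j ℤ.pred) i ℤ.suc) k ℤ.pred) j ℤ.suc
      ≡⟨ updateAt-comm suc-pred-comm _ j k ⟩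
    updateAt (updateAt (updateAt (updateAt v j ℤ.pred) i ℤ.suc) j ℤ.suc) k ℤ.pred
      ≡⟨ cong (λ w → updateAt w k ℤ.pred) (updateAt-comm (λ _ → refl) _ j i) ⟩
    updateAt (updateAt (updateAt (updateAt v j ℤ.pred) j ℤ.suc) i ℤ.suc) k ℤ.pred
      ≡⟨ cong (λ w → updateAt (updateAt w i ℤ.suc) k ℤ.pred) (updateAt-updateAt j v) ⟩
    updateAt (updateAt (updateAt v j (ℤ.suc ∘ ℤ.pred)) i ℤ.suc) k ℤ.pred
      ≡⟨ cong (λ w → updateAt (updateAt w i ℤ.suc) k ℤ.pred)
           (updateAt-id-local j v (ℤ.suc-pred (lookup v j))) ⟩
    updateAt (updateAt v i ℤ.suc) k ℤ.pred
      ≡⟨ updateAt-comm suc-pred-comm v i k ⟨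
    updateAt (updateAt v k ℤ.pred) i ℤ.suc ∎
    where open ≡-Reasoning

  -- Rerouting has to preserve the cost too, which is why a unit is charged j - i.
  span-trans : span (pair i j i<j) ℕ.+ span (pair j k j<k) ≡
               span (pair i k (Fin.<-trans i<j j<k))
  span-trans = begin
    (toℕ j ∸ toℕ i) ℕ.+ (toℕ k ∸ toℕ j) ≡⟨ ℕ.+-comm (toℕ j ∸ toℕ i) _ ⟩
    (toℕ k ∸ toℕ j) ℕ.+ (toℕ j ∸ toℕ i) ≡⟨ ℕ.+-∸-assoc (toℕ k ∸ toℕ j) (ℕ.<⇒≤ i<j) ⟨
    (toℕ k ∸ toℕ j) ℕ.+ toℕ j ∸ toℕ i   ≡⟨ cong (_∸ toℕ i) (ℕ.m∸n+n≡m (ℕ.<⇒≤ j<k)) ⟩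
    toℕ k ∸ toℕ i                       ∎
    where open ≡-Reasoning

-- Functionals of the net flow, and sums over the flows along an edge

-- A function of the net flow v and of a budget b, where a unit of flow along
-- (i , j) costs j − i; the budget serves to make the sums over flows finite.

record Functional (N : ℕ) : Set where
  no-eta-equality
  field
    value : Vec ℤ N → ℕ → ℤ

open Functional public

infix  4 _≐_
infixl 6 _⊕_

-- A record, so that the two functionals can be inferred from an equation.
record _≐_ (h h′ : Functional N) : Set where
  constructor pointwise
  field
    at-flow : ∀ v b → value h v b ≡ value h′ v b

open _≐_

_⊕_ : Functional N → Functional N → Functional N
(h ⊕ h′) .value v b = value h v b + value h′ v b

≐-refl : {h : Functional N} → h ≐ h
≐-refl .at-flow v b = refl

≐-sym : {g h : Functional N} → g ≐ h → h ≐ g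
≐-sym p .at-flow v b = sym (p .at-flow v b)

infixr 5 _⨾_

_⨾_ : {f g h : Functional N} → f ≐ g → g ≐ h → f ≐ h
(p ⨾ q) .at-flow v b = trans (p .at-flow v b) (q .at-flow v b)

⊕-cong : {g g′ h h′ : Functional N} → g ≐ g′ → h ≐ h′ → g ⊕ h ≐ g′ ⊕ h′
⊕-cong p q .at-flow v b = cong₂ _+_ (p .at-flow v b) (q .at-flow v b)

⊕-congʳ : (g : Functional N) {h h′ : Functional N} → h ≐ h′ → g ⊕ h ≐ g ⊕ h′
⊕-congʳ g q .at-flow v b = cong (value g v b +_) (q .at-flow v b)

-- One more unit of flow is sent along `e` and paid for; the value is 0 when the budget falls short.
push : Pair N → Functional N → Functional N
push e h .value v = delay (span e) (value h (transport e v))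

push-cong : ∀ (e : Pair N) {h h′} → h ≐ h′ → push e h ≐ push e h′
push-cong e p .at-flow v b = delay-cong (span e) b (p .at-flow (transport e v))

push-⊕ : ∀ (e : Pair N) h h′ → push e (h ⊕ h′) ≐ push e h ⊕ push e h′
push-⊕ e h h′ .at-flow v b = delay-+ (span e) _ _ b

push-comm : ∀ (e f : Pair N) h → push e (push f h) ≐ push f (push e h)
push-comm e f h .at-flow v b = begin
  delay (span e) (delay (span f) (value h (transport f (transport e v)))) b
    ≡⟨ delay-delay (span e) (span f) _ b ⟩
  delay (span e ℕ.+ span f) (value h (transport f (transport e v))) b
    ≡⟨ cong₂ (λ d w → delay d (value h w) b) (ℕ.+-comm (span e) _) (transport-comm f e v) ⟩
  delay (span f ℕ.+ span e) (value h (transport e (transport f v))) b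
    ≡⟨ delay-delay (span f) (span e) _ b ⟨
  delay (span f) (delay (span e) (value h (transport e (transport f v)))) b ∎
  where open ≡-Reasoning

push-trans : ∀ {i j k : Fin N} (i<j : i < j) (j<k : j < k) h →
             push (pair i j i<j) (push (pair j k j<k) h) ≐ push (pair i k (Fin.<-trans i<j j<k)) h
push-trans i<j j<k h .at-flow v b = trans (delay-delay (span (pair _ _ i<j)) (span (pair _ _ j<k)) _ b)
  (cong₂ (λ d w → delay d (value h w) b) (span-trans i<j j<k) (transport-trans i<j j<k v))

-- Since pushing strictly lowers the budget, X = push e (h ⊕ X) has a unique
-- solution X.

Solves : Pair N → Functional N → Functional N → Set
Solves e h X = X ≐ push e (h ⊕ X)

-- Induction on the budget, for all net flows at once because `push` changes the net flow too.
solution-unique : ∀ (e : Pair N) {h X Y} → Solves e h X → Solves e h Y → X ≐ Y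
solution-unique e {h} {X} {Y} sX sY .at-flow v b = <-rec (λ b → ∀ v → value X v b ≡ value Y v b) step b v
  where
  step : ∀ b → (∀ {b′} → b′ ℕ.< b → ∀ v → value X v b′ ≡ value Y v b′) → ∀ v → value X v b ≡ value Y v b
  step b rec v = trans (sX .at-flow v b) (trans
    (delay-local-< (span e) b (0<span e) λ b′ b′<b → cong (value h (transport e v) b′ +_) (rec b′<b _))
    (sym (sY .at-flow v b)))

-- The equation unrolled `n` times from 0: the part of the sum with at most `n` units on `e`.
iterate : ℕ → Pair N → Functional N → Functional N
iterate zero    e h .value v b = 0ℤ
iterate (suc n) e h = push e (h ⊕ iterate n e h)

-- A unit costs at least 1, so a budget `b` pays for at most `b` units and deeper unrolling adds
-- nothing.
iterate-stable : ∀ m n (e : Pair N) h v b → b ℕ.≤ m → b ℕ.≤ n →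
                 value (iterate m e h) v b ≡ value (iterate n e h) v b
iterate-stable zero    zero    e h v b       _ _ = refl
iterate-stable zero    (suc n) e h v zero    _ _ = sym (delay-> (span e) _ 0 (0<span e))
iterate-stable (suc m) zero    e h v zero    _ _ = delay-> (span e) _ 0 (0<span e)
iterate-stable (suc m) (suc n) e h v b b≤m b≤n =
  delay-local-< (span e) b (0<span e) λ b′ b′<b → cong (value h (transport e v) b′ +_)
    (iterate-stable m n e h (transport e v) b′ (below b′<b b≤m) (below b′<b b≤n))
  where
  below : ∀ {b b′ n} → b′ ℕ.< b → b ℕ.≤ suc n → b′ ℕ.≤ n
  below p q = ℕ.s≤s⁻¹ (ℕ.≤-trans p q)

-- ∑flows e h v b is the sum of h (v + a (e_lo − e_hi)) (b − a · span e) over all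
-- a ≥ 1 with a · span e ≤ b.

∑flows : Pair N → Functional N → Functional N
∑flows e h .value v b = value (iterate b e h) v b

∑flows-solves : ∀ (e : Pair N) h → Solves e h (∑flows e h)
∑flows-solves e h .at-flow v b = trans
  -- One more unrolling exposes the outer `push`; then the depth `b` is exchanged for the depth `b′`
  -- at each smaller budget `b′`.
  (iterate-stable b (suc b) e h v b ℕ.≤-refl (ℕ.n≤1+n b))
  (delay-local (span e) b λ b′ b′≤b → cong (value h (transport e v) b′ +_)
    (iterate-stable b b′ e h _ b′ b′≤b ℕ.≤-refl))

-- The tool for the identities of `∑flows` below: it suffices that the other side solves the
-- defining equation.
∑flows-unique : ∀ (e : Pair N) {h X} → Solves e h X → X ≐ ∑flows e h
∑flows-unique e sX = solution-unique e sX (∑flows-solves e _)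

∑flows-cong : ∀ (e : Pair N) {h h′} → h ≐ h′ → ∑flows e h ≐ ∑flows e h′
∑flows-cong e {h} p = ∑flows-unique e
  (∑flows-solves e h ⨾ push-cong e (⊕-cong p ≐-refl))

⊕-interchange : (g g′ h h′ : Functional N) → (g ⊕ h) ⊕ (g′ ⊕ h′) ≐ (g ⊕ g′) ⊕ (h ⊕ h′)
⊕-interchange g g′ h h′ .at-flow v b =
  interchange ℤ.+-commutativeSemigroup (value g v b) (value h v b) (value g′ v b) (value h′ v b)

∑flows-⊕ : ∀ (e : Pair N) h h′ → ∑flows e (h ⊕ h′) ≐ ∑flows e h ⊕ ∑flows e h′
∑flows-⊕ e h h′ = ≐-sym (∑flows-unique e
  ( ⊕-cong (∑flows-solves e h) (∑flows-solves e h′)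
  ⨾ ≐-sym (push-⊕ e _ _)
  ⨾ push-cong e (⊕-interchange h h′ (∑flows e h) (∑flows e h′)) ))

push-∑flows : ∀ (e f : Pair N) h → push e (∑flows f h) ≐ ∑flows f (push e h)
push-∑flows e f h = ∑flows-unique f
  ( push-cong e (∑flows-solves f h)
  ⨾ push-comm e f _
  ⨾ push-cong f (push-⊕ e h (∑flows f h)) )

∑flows-comm : ∀ (e f : Pair N) h → ∑flows e (∑flows f h) ≐ ∑flows f (∑flows e h)
∑flows-comm e f h = ≐-sym (∑flows-unique e
  ( ∑flows-cong f (∑flows-solves e h)
  ⨾ ≐-sym (push-∑flows e f _)
  ⨾ push-cong e (∑flows-⊕ f h (∑flows e h)) ))

-- The reduction rule for sums over flows

module _ {i j k : Fin N} (i<j : i < j) (j<k : j < k) where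

  private
    ij = pair i j i<j
    jk = pair j k j<k
    ik = pair i k (Fin.<-trans i<j j<k)

  -- Take one unit off both edges: together they are one unit on `ik`. What remains is no flow, flow
  -- on one of the edges, or flow on both, which gives `h`, `Uij`, `Ujk` and the double sum again.
  -- So the double sum solves the equation for `ik` with `Uij ⊕ (Ujk ⊕ h)` in place of `h`.
  ∑flows-reduce : ∀ h → ∑flows ij (∑flows jk h) ≐
    ∑flows ik (∑flows ij h) ⊕ (∑flows jk (∑flows ik h) ⊕ ∑flows ik h)
  ∑flows-reduce h = ∑flows-unique ik solves ⨾ expand
    where
    Uij = ∑flows ij h
    Ujk = ∑flows jk h

    solves : Solves ik (Uij ⊕ (Ujk ⊕ h)) (∑flows ij Ujk)
    solves = ∑flows-cong ij (∑flows-solves jk h)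
      ⨾ ≐-sym (push-∑flows jk ij (h ⊕ Ujk))
      ⨾ push-cong jk (∑flows-solves ij (h ⊕ Ujk))
      ⨾ push-comm jk ij _
      ⨾ push-trans i<j j<k _
      ⨾ push-cong ik (⊕-congʳ (h ⊕ Ujk) (∑flows-⊕ ij h Ujk))
      ⨾ push-cong ik (pointwise λ v b →
          rearrange (value h v b) (value Ujk v b) (value Uij v b) (value (∑flows ij Ujk) v b))
      where
      rearrange : ∀ p q r s → (p + q) + (r + s) ≡ (r + (q + p)) + s
      rearrange p q r s = trans (sym (ℤ.+-assoc (p + q) r s))
        (cong (_+ s) (trans (ℤ.+-comm (p + q) r) (cong (r +_) (ℤ.+-comm p q))))

    expand : ∑flows ik (Uij ⊕ (Ujk ⊕ h)) ≐
             ∑flows ik Uij ⊕ (∑flows jk (∑flows ik h) ⊕ ∑flows ik h)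
    expand = ∑flows-⊕ ik Uij (Ujk ⊕ h)
      ⨾ ⊕-congʳ (∑flows ik Uij)
          (∑flows-⊕ ik Ujk h ⨾ ⊕-cong (∑flows-comm ik jk h) ≐-refl)

∑allFlows : List (Pair N) → Functional N → Functional N
∑allFlows []       h = h
∑allFlows (e ∷ es) h = ∑flows e (∑allFlows es h)

∑allFlows-↭ : ∀ {es fs : List (Pair N)} → es ↭ fs → ∀ h → ∑allFlows es h ≐ ∑allFlows fs h
∑allFlows-↭ ↭.refl         h = ≐-refl
∑allFlows-↭ (↭.prep e p)   h = ∑flows-cong e (∑allFlows-↭ p h)
∑allFlows-↭ (↭.swap e f p) h = ∑flows-comm e f _ ⨾ ∑flows-cong f (∑flows-cong e (∑allFlows-↭ p h))
∑allFlows-↭ (↭.trans p q)  h = ∑allFlows-↭ p h ⨾ ∑allFlows-↭ q h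

-- A functional detecting the number of edges of alternating graphs

positivePart : ℤ → ℕ
positivePart (ℤ.+ n)    = n
positivePart ℤ.-[1+ n ] = 0

outflow : Vec ℤ N → ℕ
outflow []      = 0
outflow (x ∷ v) = positivePart x ℕ.+ outflow v

outflow-suc : ∀ (v : Vec ℤ N) i → 0ℤ ℤ.≤ lookup v i → outflow (updateAt v i ℤ.suc) ≡ suc (outflow v)
outflow-suc (ℤ.+ n ∷ v) zero    _   = refl
outflow-suc (x ∷ v)     (suc i) 0≤x =
  trans (cong (positivePart x ℕ.+_) (outflow-suc v i 0≤x)) (ℕ.+-suc (positivePart x) (outflow v))

outflow-pred : ∀ (v : Vec ℤ N) i → lookup v i ℤ.≤ 0ℤ → outflow (updateAt v i ℤ.pred) ≡ outflow v
outflow-pred (ℤ.+ zero ∷ v)    zero    _   = refl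
outflow-pred (ℤ.+ suc n ∷ v)   zero    (ℤ.+≤+ ())
outflow-pred (ℤ.-[1+ n ] ∷ v)  zero    _   = refl
outflow-pred (x ∷ v)           (suc i) x≤0 = cong (positivePart x ℕ.+_) (outflow-pred v i x≤0)

0≤transport : ∀ (e : Pair N) v p → p ≢ hi e → 0ℤ ℤ.≤ lookup v p → 0ℤ ℤ.≤ lookup (transport e v) p
0≤transport (pair i j _) v p p≢j 0≤vp with p Fin.≟ i
... | yes refl = subst (0ℤ ℤ.≤_)
        (sym (trans (lookup∘updateAt i (updateAt v j ℤ.pred)) (cong ℤ.suc (lookup∘updateAt′ i j p≢j v))))
        (ℤ.i≤j⇒i≤1+j 0≤vp)
... | no  p≢i  = subst (0ℤ ℤ.≤_)
        (sym (trans (lookup∘updateAt′ p i p≢i (updateAt v j ℤ.pred)) (lookup∘updateAt′ p j p≢j v))) 0≤vp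

transport≤0 : ∀ (e : Pair N) v p → p ≢ lo e → lookup v p ℤ.≤ 0ℤ → lookup (transport e v) p ℤ.≤ 0ℤ
transport≤0 (pair i j _) v p p≢i vp≤0 with p Fin.≟ j
... | yes refl = subst (ℤ._≤ 0ℤ)
        (sym (trans (lookup∘updateAt′ j i p≢i (updateAt v j ℤ.pred)) (lookup∘updateAt j v)))
        (ℤ.i≤j⇒pred[i]≤j vp≤0)
... | no  p≢j  = subst (ℤ._≤ 0ℤ)
        (sym (trans (lookup∘updateAt′ p i p≢i (updateAt v j ℤ.pred)) (lookup∘updateAt′ p j p≢j v))) vp≤0

-- γ k d s stands for g (k − d) s, where g r = 0 for r < 0, where g 0 s = 1 if s = 0
-- and 0 otherwise, and where g r s = (−1)^(r − s) C(r − 1 , s − 1) for r > 0.  Then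
-- Σ_{a ≥ 1} g r (s + a) = g (r − 1) s.

γ : ℕ → ℕ → ℕ → ℤ
γ zero    zero    zero    = ℤ.1ℤ
γ zero    zero    (suc s) = 0ℤ
γ (suc k) zero    zero    = 0ℤ
γ (suc k) zero    (suc s) = γ k zero s - γ k zero (suc s)
γ zero    (suc d) s       = 0ℤ
γ (suc k) (suc d) s       = γ k d s

-- Pascal's rule with signs. It is the equation for the sum over one further edge: its first unit
-- raises `s` by one, and then it carries either no more flow (`d`) or some more (`suc d`).
γ-telescope : ∀ k d s → γ k d (suc s) + γ k (suc d) (suc s) ≡ γ k (suc d) s
γ-telescope zero    zero    s = refl
γ-telescope zero    (suc d) s = refl
γ-telescope (suc k) (suc d) s = γ-telescope k d s
γ-telescope (suc k) zero    s = begin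
  γ k 0 s - γ k 0 (suc s) + γ k 0 (suc s)            ≡⟨ ℤ.+-assoc (γ k 0 s) _ _ ⟩
  γ k 0 s + (ℤ.- γ k 0 (suc s) + γ k 0 (suc s))      ≡⟨ cong (γ k 0 s +_) (ℤ.+-inverseˡ (γ k 0 (suc s))) ⟩
  γ k 0 s + 0ℤ                                       ≡⟨ ℤ.+-identityʳ (γ k 0 s) ⟩
  γ k 0 s                                            ∎
  where open ≡-Reasoning

-- g r s = 0 for r < s, like the binomial coefficient. Flows of large total thus contribute nothing,
-- and a finite budget loses nothing.
γ-vanishes : ∀ k d s → k ℕ.< s ℕ.+ d → γ k d s ≡ 0ℤ
γ-vanishes zero    zero    (suc s) _     = refl
γ-vanishes zero    (suc d) s       _     = refl
γ-vanishes (suc k) (suc d) s       k<s+d =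
  γ-vanishes k d s (ℕ.s<s⁻¹ (subst (suc k ℕ.<_) (ℕ.+-suc s d) k<s+d))
γ-vanishes (suc k) zero    (suc s) (s≤s k<s) =
  cong₂ _-_ (γ-vanishes k zero s k<s) (γ-vanishes k zero (suc s) (ℕ.m≤n⇒m≤1+n k<s))

[_] : Bool → ℕ
[ b ] = if b then 1 else 0

-- At s = 0 the coefficient C(r - 1 , -1) is 0 for r > 0, so only r = 0 survives.
γ-δ : ∀ k d → γ k d 0 ≡ ℤ.+ [ does (d ℕ.≟ k) ]
γ-δ zero    zero    = refl
γ-δ zero    (suc d) = refl
γ-δ (suc k) zero    = refl
γ-δ (suc k) (suc d) = γ-δ k d

gauge : ℕ → Functional N
gauge k .value v b = γ k 0 (outflow v)

Alternating : List (Pair N) → Set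
Alternating es = ∀ {e f} → e ∈ es → f ∈ es → hi e ≢ lo f

-- In an alternating graph, lo e only emits flow and hi e only receives it, so
-- that the outflow of the net flow is the total flow.

Admissible : Vec ℤ N → List (Pair N) → Set
Admissible v es = ∀ {e} → e ∈ es → 0ℤ ℤ.≤ lookup v (lo e) × lookup v (hi e) ℤ.≤ 0ℤ

transport-admissible : ∀ e (es : List (Pair N)) v → Alternating (e ∷ es) →
                       Admissible v (e ∷ es) → Admissible (transport e v) (e ∷ es)
transport-admissible e es v alt adm {f} f∈ =
    0≤transport e v (lo f) (λ eq → alt (here refl) f∈ (sym eq)) (proj₁ (adm f∈))
  , transport≤0 e v (hi f) (alt f∈ (here refl)) (proj₂ (adm f∈))

-- The entry at `lo e` is nonnegative and rises, the one at `hi e` is nonpositive and falls, so only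
-- the first affects the outflow.
outflow-transport : ∀ e (es : List (Pair N)) v → Alternating (e ∷ es) → Admissible v (e ∷ es) →
                    outflow (transport e v) ≡ suc (outflow v)
outflow-transport e@(pair i j _) es v alt adm = trans
  (outflow-suc (updateAt v j ℤ.pred) i (subst (0ℤ ℤ.≤_)
    (sym (lookup∘updateAt′ i j (λ i≡j → alt (here refl) (here refl) (sym i≡j)) v))
    (proj₁ (adm (here refl)))))
  (cong suc (outflow-pred v j (proj₂ (adm (here refl)))))

-- Induction on the edges and, inside it, on the budget. The inequality says that the budget
-- suffices to raise the outflow to `k`, each unit costing at most `N`.
∑allFlows-gauge : ∀ k (es : List (Pair N)) v b → Alternating es → Admissible v es →
                  N ℕ.* k ℕ.≤ b ℕ.+ N ℕ.* outflow v →
                  value (∑allFlows es (gauge k)) v b ≡ γ k (length es) (outflow v)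
∑allFlows-gauge         k []       v b _   _   _  = refl
∑allFlows-gauge {N = N} k (e ∷ es) v b alt adm le = <-rec Goal step b v adm le
  where
  d = length es
  h = ∑allFlows es (gauge k)

  Goal : ℕ → Set
  Goal b = ∀ v → Admissible v (e ∷ es) → N ℕ.* k ℕ.≤ b ℕ.+ N ℕ.* outflow v →
           value (∑flows e h) v b ≡ γ k (suc d) (outflow v)

  step : ∀ b → (∀ {b′} → b′ ℕ.< b → Goal b′) → Goal b
  step b rec v adm le with span e ℕ.≤? b
  ... | yes span≤b = begin
    value (∑flows e h) v b
      ≡⟨ at-flow (∑flows-solves e h) v b ⟩
    delay (span e) (value (h ⊕ ∑flows e h) w) b
      ≡⟨ delay-≤ (span e) _ b span≤b ⟩
    value h w (b ∸ span e) + value (∑flows e h) w (b ∸ span e)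
      ≡⟨ cong₂ _+_ (∑allFlows-gauge k es w _ (λ p q → alt (there p) (there q)) (adm′ ∘ there) le′)
                   (rec (ℕ.∸-monoʳ-< (0<span e) span≤b) w adm′ le′) ⟩
    γ k d (outflow w) + γ k (suc d) (outflow w)
      ≡⟨ cong (λ s → γ k d s + γ k (suc d) s) outflow-w ⟩
    γ k d (suc (outflow v)) + γ k (suc d) (suc (outflow v))
      ≡⟨ γ-telescope k d (outflow v) ⟩
    γ k (suc d) (outflow v) ∎
    where
    open ≡-Reasoning
    w = transport e v
    adm′ = transport-admissible e es v alt adm
    outflow-w = outflow-transport e es v alt adm

    -- The budget drops by at most `N` while the outflow grows by one.
    le′ : N ℕ.* k ℕ.≤ b ∸ span e ℕ.+ N ℕ.* outflow w
    le′ = ℕ.≤-trans le (ℕ.≤-trans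
      (ℕ.+-monoˡ-≤ _ (ℕ.≤-trans (ℕ.≤-reflexive (sym (ℕ.m∸n+n≡m span≤b)))
                                (ℕ.+-monoʳ-≤ (b ∸ span e) (span≤N e))))
      (ℕ.≤-reflexive (trans (ℕ.+-assoc (b ∸ span e) N _)
        (cong (b ∸ span e ℕ.+_) (sym (trans (cong (N ℕ.*_) outflow-w) (ℕ.*-suc N (outflow v))))))))
  -- Not even one unit can be paid for, so b < N and the inequality gives k ≤ `outflow v`; both
  -- sides are 0.
  ... | no span≰b = trans (at-flow (∑flows-solves e h) v b)
    (trans (delay-> (span e) _ b (ℕ.≰⇒> span≰b))
           (sym (γ-vanishes k (suc d) (outflow v)
             (ℕ.≤-trans k<1+s (ℕ.≤-trans (s≤s (ℕ.m≤m+n _ d)) (ℕ.≤-reflexive (sym (ℕ.+-suc _ d))))))))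
    where
    k<1+s : k ℕ.< suc (outflow v)
    k<1+s = ℕ.*-cancelˡ-< N k (suc (outflow v)) (ℕ.≤-<-trans le (ℕ.<-≤-trans
      (ℕ.+-monoˡ-< _ (ℕ.<-≤-trans (ℕ.≰⇒> span≰b) (span≤N e)))
      (ℕ.≤-reflexive (sym (ℕ.*-suc N (outflow v))))))

-- From zero net flow, the budget N · k pays for `k` units on any edges.
weight : ℕ → List (Pair N) → ℤ
weight {N} k es = value (∑allFlows es (gauge k)) (Vec.replicate N 0ℤ) (N ℕ.* k)

weight-↭ : ∀ k {es fs : List (Pair N)} → es ↭ fs → weight k es ≡ weight k fs
weight-↭ {N = N} k p = at-flow (∑allFlows-↭ p (gauge k)) (Vec.replicate N 0ℤ) (N ℕ.* k)

weight-reduce : ∀ k {i j l : Fin N} (i<j : i < j) (j<l : j < l) es →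
  let ij = pair i j i<j ; jl = pair j l j<l ; il = pair i l (Fin.<-trans i<j j<l) in
  weight k (ij ∷ jl ∷ es) ≡ weight k (il ∷ ij ∷ es) + (weight k (jl ∷ il ∷ es) + weight k (il ∷ es))
weight-reduce {N = N} k i<j j<l es = at-flow (∑flows-reduce i<j j<l (∑allFlows es (gauge k)))
  (Vec.replicate N 0ℤ) (N ℕ.* k)

weight-alternating : ∀ k (es : List (Pair N)) → Alternating es →
                     weight k es ≡ ℤ.+ [ does (length es ℕ.≟ k) ]
weight-alternating {N} k es alt = begin
  weight k es                 ≡⟨ ∑allFlows-gauge k es zeros (N ℕ.* k) alt adm (ℕ.m≤m+n _ _) ⟩
  γ k (length es) (outflow zeros) ≡⟨ cong (γ k (length es)) (outflow-0 N) ⟩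
  γ k (length es) 0           ≡⟨ γ-δ k (length es) ⟩
  ℤ.+ [ does (length es ℕ.≟ k) ] ∎
  where
  open ≡-Reasoning
  zeros = Vec.replicate N 0ℤ
  outflow-0 : ∀ N → outflow (Vec.replicate N 0ℤ) ≡ 0
  outflow-0 zero    = refl
  outflow-0 (suc N) = outflow-0 N
  adm : Admissible zeros es
  adm {e} _ = ℤ.≤-reflexive (sym (lookup-replicate (lo e) 0ℤ))
            , ℤ.≤-reflexive (lookup-replicate (hi e) 0ℤ)

-- Tables of exponents as multisets of edges

support : Vec ℕ N → List (Fin N)
support []      = []
support (c ∷ v) = replicate c zero ++ map suc (support v)

fromZero : Fin N → Pair (suc N)
fromZero j = pair zero (suc j) (s≤s z≤n)

sucPair : Pair N → Pair (suc N)
sucPair (pair i j i<j) = pair (suc i) (suc j) (s≤s i<j)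

edges : Table ℕ N → List (Pair N)
edges []        = []
edges (row ∷ t) = map fromZero (support row) ++ map sucPair (edges t)

replicate-+ : ∀ m n (a : A) → replicate (m ℕ.+ n) a ≡ replicate m a ++ replicate n a
replicate-+ zero    n a = refl
replicate-+ (suc m) n a = cong (a ∷_) (replicate-+ m n a)

map-++-split : ∀ {B : Set} (f : A → B) {xs} ys zs → xs ↭ ys ++ zs → map f xs ↭ map f ys ++ map f zs
map-++-split f ys zs p = ↭-trans (map⁺ f p) (↭-reflexive (map-++ f ys zs))

++-interchange : ∀ (as bs cs ds : List A) → (as ++ bs) ++ (cs ++ ds) ↭ (as ++ cs) ++ (bs ++ ds)
++-interchange = interchange (CommutativeMonoid.commutativeSemigroup ++-commutativeMonoid)

support-+ : ∀ (v w : Vec ℕ N) → support (Vec.zipWith ℕ._+_ v w) ↭ support v ++ support w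
support-+ []      []      = ↭-refl
support-+ (c ∷ v) (d ∷ w) = ↭-trans
  (++⁺ (↭-reflexive (replicate-+ c d zero)) (map-++-split suc (support v) (support w) (support-+ v w)))
  (++-interchange (replicate c zero) _ _ _)

edges-+ : ∀ (t u : Table ℕ N) → edges (zipTable ℕ._+_ t u) ↭ edges t ++ edges u
edges-+ []        []        = ↭-refl
edges-+ (row ∷ t) (col ∷ u) = ↭-trans
  (++⁺ (map-++-split fromZero (support row) (support col) (support-+ row col))
       (map-++-split sucPair (edges t) (edges u) (edges-+ t u)))
  (++-interchange (map fromZero (support row)) _ _ _)

support-0 : ∀ N → support (Vec.replicate N 0) ≡ []
support-0 zero    = refl
support-0 (suc N) = cong (map suc) (support-0 N)

support-unit : ∀ (j : Fin N) → support (Vec.replicate N 0 Vec.[ j ]≔ 1) ≡ j ∷ []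
support-unit {suc N} zero    = cong (λ js → zero ∷ map suc js) (support-0 N)
support-unit         (suc j) = cong (map suc) (support-unit j)

edges-0 : ∀ N → edges (constant N 0) ≡ []
edges-0 zero    = refl
edges-0 (suc N) = cong₂ (λ js es → map fromZero js ++ map sucPair es) (support-0 N) (edges-0 N)

unit : Pair N → Table ℕ N
unit {N} e = constant N 0 [ e ]≔ 1

edges-unit : ∀ (e : Pair N) → edges (unit e) ≡ e ∷ []
edges-unit {suc N} (pair zero    (suc j) _) =
  cong₂ (λ js es → map fromZero js ++ map sucPair es) (support-unit j) (edges-0 N)
edges-unit {suc N} (pair (suc i) (suc j) p) =
  cong₂ (λ js es → map fromZero js ++ map sucPair es) (support-0 N) (edges-unit (pair i j (ℕ.s≤s⁻¹ p)))

edges-unit-+ : ∀ (e : Pair N) t → edges (zipTable ℕ._+_ (unit e) t) ↭ e ∷ edges t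
edges-unit-+ e t = ↭-trans (edges-+ (unit e) t) (↭-reflexive (cong (_++ edges t) (edges-unit e)))

zipTable-identityˡ : ∀ (t : Table ℕ N) → zipTable ℕ._+_ (constant N 0) t ≡ t
zipTable-identityˡ []        = refl
zipTable-identityˡ (row ∷ t) =
  cong₂ _∷_ (zipWith-identityˡ ℕ.+-identityˡ row) (zipTable-identityˡ t)

zipTable-assoc : ∀ (t u v : Table ℕ N) →
  zipTable ℕ._+_ (zipTable ℕ._+_ t u) v ≡ zipTable ℕ._+_ t (zipTable ℕ._+_ u v)
zipTable-assoc []       []       []       = refl
zipTable-assoc (r ∷ t) (r′ ∷ u) (r″ ∷ v) =
  cong₂ _∷_ (zipWith-assoc ℕ.+-assoc r r′ r″) (zipTable-assoc t u v)

support-extract : ∀ (v : Vec ℕ N) {j} → j ∈ support v →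
                  ∃[ w ] v ≡ Vec.zipWith ℕ._+_ (Vec.replicate N 0 Vec.[ j ]≔ 1) w
support-extract (c ∷ v) j∈ with ∈-++⁻ (replicate c zero) j∈
support-extract (zero  ∷ v) _ | inj₁ ()
support-extract (suc c ∷ v) _ | inj₁ j∈ with refl ← All.lookup {P = _≡ zero} (All.replicate⁺ (suc c) refl) j∈ =
  c ∷ v , cong (suc c ∷_) (sym (zipWith-identityˡ ℕ.+-identityˡ v))
support-extract (c ∷ v) _ | inj₂ j∈ with j′ , j′∈ , refl ← ∈-map⁻ suc j∈ =
  let w , eq = support-extract v j′∈ in c ∷ w , cong (c ∷_) eq

-- Turns membership of an edge into divisibility by its variable.
edges-extract : ∀ (t : Table ℕ N) {e} → e ∈ edges t → ∃[ u ] t ≡ zipTable ℕ._+_ (unit e) u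
edges-extract (row ∷ t) e∈ with ∈-++⁻ (map fromZero (support row)) e∈
... | inj₁ e∈₁ with j , j∈ , refl ← ∈-map⁻ fromZero e∈₁ =
  let w , eq = support-extract row j∈ in w ∷ t , cong₂ _∷_ eq (sym (zipTable-identityˡ t))
... | inj₂ e∈₂ with e′ , e′∈ , refl ← ∈-map⁻ sucPair e∈₂ =
  let u , eq = edges-extract t e′∈ in
  row ∷ u , cong₂ _∷_ (sym (zipWith-identityˡ ℕ.+-identityˡ row)) eq

Irreducible : Monomial N → Set
Irreducible {N} m = ∀ {i j k : Fin N} (i<j : i < j) (j<k : j < k) → ¬ x i<j · x j<k ∣ m

-- Two composable factors could be split off one after the other, exhibiting xᵢⱼ xⱼₖ as a divisor.
irreducible⇒alternating : ∀ (m : Monomial N) → Irreducible m → Alternating (edges (xExponents m))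
irreducible⇒alternating m irr {e@(pair i j i<j)} {f@(pair .j k j<k)} e∈ f∈ refl
  with u , eq ← edges-extract (xExponents m) e∈
  with ∈-resp-↭ (↭-trans (↭-reflexive (cong edges eq)) (edges-unit-+ e u)) f∈
-- If `f` were `e` itself, its two ends would coincide.
... | here refl = Fin.<-irrefl refl (lo<hi e)
... | there f∈u =
  let w , eq′ = edges-extract u f∈u in
  irr (lo<hi e) (lo<hi f)
    ( monomial w (βExponent m)
    , cong (λ t → monomial t (βExponent m))
        (trans eq (trans (cong (zipTable ℕ._+_ (unit e)) eq′) (sym (zipTable-assoc (unit e) (unit f) w)))) )

-- Graphs

at-≔ : ∀ (t : Table A N) e {a} → at (t [ e ]≔ a) e ≡ a
at-≔ (row ∷ t) (pair zero    (suc j) _) = lookup∘updateAt j row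
at-≔ (row ∷ t) (pair (suc i) (suc j) p) = at-≔ t (pair i j (ℕ.s≤s⁻¹ p))

at-≔-other : ∀ (t : Table A N) {e f} {a} → e ≢ f → at (t [ e ]≔ a) f ≡ at t f
at-≔-other (row ∷ t) {pair zero (suc j) _} {pair zero (suc j′) _} e≢f =
  lookup∘updateAt′ j′ j (λ { refl → e≢f refl }) row
at-≔-other (row ∷ t) {pair zero    (suc j) _} {pair (suc i′) (suc j′) _} e≢f = refl
at-≔-other (row ∷ t) {pair (suc i) (suc j) _} {pair zero     (suc j′) _} e≢f = refl
at-≔-other (row ∷ t) {pair (suc i) (suc j) p} {pair (suc i′) (suc j′) q} e≢f =
  at-≔-other t (λ eq → e≢f (cong sucPair eq))

≔-comm : ∀ (t : Table A N) {e f} {a b} → e ≢ f → t [ e ]≔ a [ f ]≔ b ≡ t [ f ]≔ b [ e ]≔ a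
≔-comm (row ∷ t) {pair zero (suc j) _} {pair zero (suc j′) _} e≢f =
  cong (_∷ t) ([]≔-commutes row j j′ λ { refl → e≢f refl })
≔-comm (row ∷ t) {pair zero    (suc j) _} {pair (suc i′) (suc j′) _} e≢f = refl
≔-comm (row ∷ t) {pair (suc i) (suc j) _} {pair zero     (suc j′) _} e≢f = refl
≔-comm (row ∷ t) {pair (suc i) (suc j) p} {pair (suc i′) (suc j′) q} e≢f =
  cong (row ∷_) (≔-comm t (λ eq → e≢f (cong sucPair eq)))

≔-restore : ∀ (t : Table A N) e {a b} → at t e ≡ a → t [ e ]≔ b [ e ]≔ a ≡ t
≔-restore (row ∷ t) (pair zero    (suc j) _) refl =
  cong (_∷ t) (trans ([]≔-idempotent row j) ([]≔-lookup row j))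
≔-restore (row ∷ t) (pair (suc i) (suc j) p) eq   =
  cong (row ∷_) (≔-restore t (pair i j (ℕ.s≤s⁻¹ p)) eq)

-- Defined through the monomial, so that the lemmas on exponents serve graphs as well.
edgeList : Graph N → List (Pair N)
edgeList G = edges (xExponents (graphMonomial G))

length-edgeList : ∀ (G : Graph N) → length (edgeList G) ≡ edgeCount G
length-edgeList []        = refl
length-edgeList (row ∷ G) = trans
  (length-++ (map fromZero (support (Vec.map [_] row))))
  (cong₂ ℕ._+_ (trans (length-map fromZero (support (Vec.map [_] row))) (length-support row))
               (trans (length-map sucPair (edgeList G)) (length-edgeList G)))
  where
  mutual
    length-support : ∀ {n} (row : Vec Bool n) → length (support (Vec.map [_] row)) ≡ ∣ row ∣
    length-support []          = refl
    length-support (true ∷ v)  = cong suc (length-map-suc v)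
    length-support (false ∷ v) = length-map-suc v

    length-map-suc : ∀ {n} (row : Vec Bool n) →
                     length (map (suc {n}) (support (Vec.map [_] row))) ≡ ∣ row ∣
    length-map-suc v = trans (length-map suc (support (Vec.map [_] v))) (length-support v)

map-update-unit : ∀ (v : Vec Bool N) j → lookup v j ≡ false →
  Vec.map [_] (v Vec.[ j ]≔ true) ≡
  Vec.zipWith ℕ._+_ (Vec.replicate N 0 Vec.[ j ]≔ 1) (Vec.map [_] v)
map-update-unit (false ∷ v) zero    _  = cong (1 ∷_) (sym (zipWith-identityˡ ℕ.+-identityˡ _))
map-update-unit (b ∷ v)     (suc j) eq = cong ([ b ] ∷_) (map-update-unit v j eq)

-- The edge has to be new: a union merges equal edges, whereas a product of monomials adds their
-- exponents.
xExponents-∪ : ∀ (G : Graph N) e → at G e ≡ false →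
  xExponents (graphMonomial (G ∪ e)) ≡ zipTable ℕ._+_ (unit e) (xExponents (graphMonomial G))
xExponents-∪ (row ∷ G) (pair zero    (suc j) _) eq =
  cong₂ _∷_ (map-update-unit row j eq) (sym (zipTable-identityˡ _))
xExponents-∪ (row ∷ G) (pair (suc i) (suc j) p) eq =
  cong₂ _∷_ (sym (zipWith-identityˡ ℕ.+-identityˡ _)) (xExponents-∪ G (pair i j (ℕ.s≤s⁻¹ p)) eq)

edgeList-∪ : ∀ (G : Graph N) e → at G e ≡ false → edgeList (G ∪ e) ↭ e ∷ edgeList G
edgeList-∪ G e eq = ↭-trans (↭-reflexive (cong edges (xExponents-∪ G e eq))) (edges-unit-+ e _)

edgeList-∖ : ∀ (G : Graph N) e → e ∈ᴱ G → edgeList G ↭ e ∷ edgeList (G ∖ e)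
edgeList-∖ G e e∈G = ↭-trans (↭-reflexive (cong edgeList (sym (≔-restore G e e∈G))))
  (edgeList-∪ (G ∖ e) e (at-≔ G e))

at-graphMonomial : ∀ (G : Graph N) e → at (xExponents (graphMonomial G)) e ≡ [ at G e ]
at-graphMonomial (row ∷ G) (pair zero    (suc j) _) = lookup-map j [_] row
at-graphMonomial (row ∷ G) (pair (suc i) (suc j) p) = at-graphMonomial G (pair i j (ℕ.s≤s⁻¹ p))

at-+ : ∀ (t u : Table ℕ N) e → at (zipTable ℕ._+_ t u) e ≡ at t e ℕ.+ at u e
at-+ (r ∷ t) (r′ ∷ u) (pair zero    (suc j) _) = lookup-zipWith ℕ._+_ j r r′
at-+ (r ∷ t) (r′ ∷ u) (pair (suc i) (suc j) p) = at-+ t u (pair i j (ℕ.s≤s⁻¹ p))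

edgeList⁻ : ∀ (G : Graph N) {e} → e ∈ edgeList G → e ∈ᴱ G
edgeList⁻ G {e} e∈ with u , eq ← edges-extract (xExponents (graphMonomial G)) e∈ =
  1+⇒true (at G e) (begin
    [ at G e ]                        ≡⟨ at-graphMonomial G e ⟨
    at (xExponents (graphMonomial G)) e ≡⟨ cong (λ t → at t e) eq ⟩
    at (zipTable ℕ._+_ (unit e) u) e  ≡⟨ at-+ (unit e) u e ⟩
    at (unit e) e ℕ.+ at u e          ≡⟨ cong (ℕ._+ at u e) (at-≔ (constant _ 0) e) ⟩
    suc (at u e)                      ∎)
  where
  open ≡-Reasoning
  1+⇒true : ∀ b {n} → [ b ] ≡ suc n → b ≡ true
  1+⇒true true _ = refl

irreducible-graph⇒alternating : ∀ (G : Graph N) → ¬ Reduction G → Alternating (edgeList G)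
irreducible-graph⇒alternating G irr {e@(pair i j i<j)} {f@(pair .j k j<k)} e∈ f∈ refl = irr record
  { i<j  = lo<hi e
  ; j<k  = lo<hi f
  ; ij∈G = edgeList⁻ G e∈
  ; jk∈G = edgeList⁻ G f∈
  }

module _ {G : Graph N} (r : Reduction G) where

  open Reduction r

  private
    ij = pair i j i<j
    jk = pair j k j<k
    ik = pair i k (Fin.<-trans i<j j<k)

    ij≢jk : ij ≢ jk
    ij≢jk refl = Fin.<-irrefl refl i<j

    ij≢ik : ij ≢ ik
    ij≢ik refl = Fin.<-irrefl refl j<k

    jk≢ik : jk ≢ ik
    jk≢ik refl = Fin.<-irrefl refl i<j

    es = edgeList (G ∖ ij ∖ jk)

    edgeList-∖ij : edgeList (G ∖ ij) ↭ jk ∷ es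
    edgeList-∖ij = edgeList-∖ (G ∖ ij) jk (trans (at-≔-other G ij≢jk) jk∈G)

    edgeList-∖jk : edgeList (G ∖ jk) ↭ ij ∷ es
    edgeList-∖jk = ↭-trans (edgeList-∖ (G ∖ jk) ij (trans (at-≔-other G (ij≢jk ∘ sym)) ij∈G))
      (↭.prep ij (↭-reflexive (cong edgeList (≔-comm G (ij≢jk ∘ sym)))))

  -- As `ik` is new, no edges merge, and the reducts have exactly the edge lists of the three terms
  -- of `weight-reduce`.
  graph-weight-reduce : at G ik ≡ false → ∀ w → weight w (edgeList G) ≡
    weight w (edgeList (reduct₁ i<j j<k G)) +
    (weight w (edgeList (reduct₂ i<j j<k G)) + weight w (edgeList (reduct₃ i<j j<k G)))
  graph-weight-reduce ik∉G w = begin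
    weight w (edgeList G)
      ≡⟨ weight-↭ w (↭-trans (edgeList-∖ G ij ij∈G) (↭.prep ij edgeList-∖ij)) ⟩
    weight w (ij ∷ jk ∷ es)
      ≡⟨ weight-reduce w i<j j<k es ⟩
    weight w (ik ∷ ij ∷ es) + (weight w (jk ∷ ik ∷ es) + weight w (ik ∷ es))
      ≡⟨ cong₂ _+_ (weight-↭ w r₁) (cong₂ _+_ (weight-↭ w r₂) (weight-↭ w r₃)) ⟨
    weight w (edgeList (reduct₁ i<j j<k G)) +
    (weight w (edgeList (reduct₂ i<j j<k G)) + weight w (edgeList (reduct₃ i<j j<k G))) ∎
    where
    open ≡-Reasoning
    ik∉G∖ij = trans (at-≔-other G ij≢ik) ik∉G

    r₁ : edgeList (reduct₁ i<j j<k G) ↭ ik ∷ ij ∷ es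
    r₁ = ↭-trans (edgeList-∪ (G ∖ jk) ik (trans (at-≔-other G jk≢ik) ik∉G)) (↭.prep ik edgeList-∖jk)

    r₂ : edgeList (reduct₂ i<j j<k G) ↭ jk ∷ ik ∷ es
    r₂ = ↭-trans (edgeList-∪ (G ∖ ij) ik ik∉G∖ij) (↭-trans (↭.prep ik edgeList-∖ij) (↭.swap ik jk ↭-refl))

    r₃ : edgeList (reduct₃ i<j j<k G) ↭ ik ∷ es
    r₃ = edgeList-∪ (G ∖ ij ∖ jk) ik (trans (at-≔-other (G ∖ ij) jk≢ik) ik∉G∖ij)

-- Forests

Walk : Graph N → Fin N → Fin N → Set
Walk G = Star (Adjacent G)

-- Unlike the absence of cycles, this form of acyclicity is easily seen to be
-- preserved by reductions.

Bridged : Graph N → Set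
Bridged G = ∀ e → e ∈ᴱ G → ¬ Walk (G ∖ e) (lo e) (hi e)

_≟ᴾ_ : (e f : Pair N) → Dec (e ≡ f)
pair i j _ ≟ᴾ pair i′ j′ _ with i Fin.≟ i′ | j Fin.≟ j′
... | yes refl | yes refl = yes refl
... | no  i≢i′ | _        = no λ { refl → i≢i′ refl }
... | _        | no  j≢j′ = no λ { refl → j≢j′ refl }

∈-∖⁺ : ∀ (G : Graph N) {e f} → f ≢ e → f ∈ᴱ G → f ∈ᴱ G ∖ e
∈-∖⁺ G f≢e f∈G = trans (at-≔-other G (f≢e ∘ sym)) f∈G

∉-∖ : ∀ (G : Graph N) e → ¬ e ∈ᴱ G ∖ e
∉-∖ G e e∈ with () ← trans (sym (at-≔ G e)) e∈

∈-∖⁻ : ∀ (G : Graph N) {e f} → f ∈ᴱ G ∖ e → f ≢ e × f ∈ᴱ G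
∈-∖⁻ G {e} {f} f∈ with f ≟ᴾ e
... | yes refl = contradiction f∈ (∉-∖ G e)
... | no  f≢e  = f≢e , trans (sym (at-≔-other G (f≢e ∘ sym))) f∈

∈-∪⁻ : ∀ (G : Graph N) {e f} → f ∈ᴱ G ∪ e → f ≡ e ⊎ f ∈ᴱ G
∈-∪⁻ G {e} {f} f∈ with f ≟ᴾ e
... | yes f≡e = inj₁ f≡e
... | no  f≢e = inj₂ (trans (sym (at-≔-other G (f≢e ∘ sym))) f∈)

adjacent : ∀ (G : Graph N) e → e ∈ᴱ G → Adjacent G (lo e) (hi e)
adjacent G e@(pair _ _ _) e∈G = inj₁ (lo<hi e , e∈G)

adjacent-sym : ∀ (G : Graph N) {u v} → Adjacent G u v → Adjacent G v u
adjacent-sym G = Sum.swap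

edge-walk : ∀ (G : Graph N) e → e ∈ᴱ G → Walk G (lo e) (hi e)
edge-walk G e e∈G = adjacent G e e∈G ◅ ε

walk-sym : ∀ (G : Graph N) {u v} → Walk G u v → Walk G v u
walk-sym G = Star.reverse (adjacent-sym G)

walk-bind : ∀ (G H : Graph N) → (∀ e → e ∈ᴱ G → Walk H (lo e) (hi e)) →
            ∀ {u v} → Walk G u v → Walk H u v
walk-bind G H G⇒H = Star.kleisliStar (λ u → u) λ where
  (inj₁ (p , e∈)) → G⇒H (pair _ _ p) e∈
  (inj₂ (p , e∈)) → walk-sym H (G⇒H (pair _ _ p) e∈)

walk-mono : ∀ (G H : Graph N) → (∀ {e} → e ∈ᴱ G → e ∈ᴱ H) → ∀ {u v} → Walk G u v → Walk H u v
walk-mono G H G⊆H = walk-bind G H λ e e∈G → edge-walk H e (G⊆H e∈G)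

-- What remains of a walk after its last passage through e.

walk-after : ∀ (G H : Graph N) e → (∀ {f} → f ∈ᴱ G → f ≡ e ⊎ f ∈ᴱ H) →
             ∀ {u v} → Walk G u v → Walk H u v ⊎ Walk H (lo e) v ⊎ Walk H (hi e) v
walk-after G H e G⊆H ε = inj₁ ε
walk-after G H e G⊆H (a ◅ w) with walk-after G H e G⊆H w
... | inj₂ ws = inj₂ ws
... | inj₁ w′ with a
...   | inj₁ (p , f∈) = [ (λ { refl → inj₂ (inj₂ w′) }) , (λ f∈H → inj₁ (inj₁ (p , f∈H) ◅ w′)) ]′ (G⊆H f∈)
...   | inj₂ (p , f∈) = [ (λ { refl → inj₂ (inj₁ w′) }) , (λ f∈H → inj₁ (inj₂ (p , f∈H) ◅ w′)) ]′ (G⊆H f∈)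

module _ (G : Graph N) {i j k : Fin N} (i<j : i < j) (j<k : j < k)
         (ij∈G : pair i j i<j ∈ᴱ G) (jk∈G : pair j k j<k ∈ᴱ G) where

  private
    ij = pair i j i<j
    jk = pair j k j<k
    ik = pair i k (Fin.<-trans i<j j<k)

    ij≢jk : ij ≢ jk
    ij≢jk refl = Fin.<-irrefl refl i<j

    ij≢ik : ij ≢ ik
    ij≢ik refl = Fin.<-irrefl refl j<k

    jk≢ik : jk ≢ ik
    jk≢ik refl = Fin.<-irrefl refl i<j

    detour : ∀ e → ij ≢ e → jk ≢ e → Walk (G ∖ e) i k
    detour e ij≢e jk≢e = edge-walk (G ∖ e) ij (∈-∖⁺ G ij≢e ij∈G) ◅◅
                         edge-walk (G ∖ e) jk (∈-∖⁺ G jk≢e jk∈G)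

  -- An edge `ik` would be bypassed by `ij` followed by `jk`.
  bridged⇒ik∉ : Bridged G → at G ik ≡ false
  bridged⇒ik∉ bridged with at G ik in eq
  ... | false = refl
  ... | true  = contradiction (detour ik ij≢ik jk≢ik) (bridged ik eq)

  -- Deleting ij and jk separates j from both i and k, even if ik is added.

  j-isolated : Bridged G → ∀ (K : Graph N) →
               (∀ {f} → f ∈ᴱ K → f ≢ ij × f ≢ jk × (f ≡ ik ⊎ f ∈ᴱ G)) →
               ¬ Walk K i j × ¬ Walk K k j
  j-isolated bridged K K⊆ = split i↛j , split k↛j
    where
    H = G ∖ ij ∖ jk

    K⊆H : ∀ {f} → f ∈ᴱ K → f ≡ ik ⊎ f ∈ᴱ H
    K⊆H f∈K with f≢ij , f≢jk , f∈ ← K⊆ f∈K =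
      Sum.map₂ (λ f∈G → ∈-∖⁺ (G ∖ ij) f≢jk (∈-∖⁺ G f≢ij f∈G)) f∈

    i↛j : ¬ Walk H i j
    i↛j w = bridged ij ij∈G (walk-mono H (G ∖ ij) (proj₂ ∘ ∈-∖⁻ (G ∖ ij)) w)

    k↛j : ¬ Walk H k j
    k↛j w = bridged jk jk∈G (walk-sym (G ∖ jk) (walk-mono H (G ∖ jk) H⊆G∖jk w))
      where
      H⊆G∖jk : ∀ {f} → f ∈ᴱ H → f ∈ᴱ G ∖ jk
      H⊆G∖jk f∈H with f≢jk , f∈ ← ∈-∖⁻ (G ∖ ij) f∈H = ∈-∖⁺ G f≢jk (proj₂ (∈-∖⁻ G f∈))

    split : ∀ {u} → ¬ Walk H u j → ¬ Walk K u j
    split u↛j w = [ u↛j , [ i↛j , k↛j ]′ ]′ (walk-after K H ik K⊆H w)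

  -- Treats the three reducts at once, as subgraphs of `G ∪ ik` that lack `ij` or `jk`.
  bridged-reduct : ∀ (K : Graph N) → (∀ {f} → f ∈ᴱ K → f ≡ ik ⊎ f ∈ᴱ G) →
                   ¬ ij ∈ᴱ K ⊎ ¬ jk ∈ᴱ K → Bridged G → Bridged K
  bridged-reduct K K⊆ missing bridged e e∈K w with e ≟ᴾ ik
  -- The walk from i to k runs in `G` without the missing edge; continued along the other of the two
  -- edges, it joins the ends of the missing one.
  ... | yes refl = [ (λ ij∉K → bridged ij ij∈G (walk-mono (K ∖ ik) (G ∖ ij) (⊆-∖ ij∉K) w ◅◅
                                 walk-sym (G ∖ ij) (edge-walk (G ∖ ij) jk (∈-∖⁺ G (ij≢jk ∘ sym) jk∈G))))
                   , (λ jk∉K → bridged jk jk∈G (walk-sym (G ∖ jk) (edge-walk (G ∖ jk) ij (∈-∖⁺ G ij≢jk ij∈G)) ◅◅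
                                 walk-mono (K ∖ ik) (G ∖ jk) (⊆-∖ jk∉K) w))
                   ]′ missing
    where
    ⊆-∖ : ∀ {g} → ¬ g ∈ᴱ K → ∀ {f} → f ∈ᴱ K ∖ ik → f ∈ᴱ G ∖ g
    ⊆-∖ g∉K f∈ with f≢ik , f∈K ← ∈-∖⁻ K f∈ =
      ∈-∖⁺ G (λ { refl → g∉K f∈K }) ([ (λ f≡ik → contradiction f≡ik f≢ik) , (λ f∈G → f∈G) ]′ (K⊆ f∈K))
  ... | no e≢ik with e ≟ᴾ ij | e ≟ᴾ jk
  -- Here `jk` is the missing edge, so deleting `ij` removes the second of the two and cuts j off
  -- from i.
  ...   | yes refl | _        = proj₁ (j-isolated bridged (K ∖ ij) λ f∈ → let f≢ij , f∈K = ∈-∖⁻ K f∈ in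
      f≢ij , (λ { refl → [ (λ ij∉K → ij∉K e∈K) , (λ jk∉K → jk∉K f∈K) ]′ missing }) , K⊆ f∈K) w
  ...   | no _     | yes refl = proj₂ (j-isolated bridged (K ∖ jk) λ f∈ → let f≢jk , f∈K = ∈-∖⁻ K f∈ in
      (λ { refl → [ (λ ij∉K → ij∉K f∈K) , (λ jk∉K → jk∉K e∈K) ]′ missing }) , f≢jk , K⊆ f∈K)
      (walk-sym (K ∖ jk) w)
  -- Steps along `ik` are replaced by `ij` and `jk`, both different from `e`, which gives a walk
  -- around `e` in `G`.
  ...   | no e≢ij  | no e≢jk  = bridged e e∈G (walk-bind (K ∖ e) (G ∖ e) bypass w)
    where
    e∈G = [ (λ e≡ik → contradiction e≡ik e≢ik) , (λ e∈G → e∈G) ]′ (K⊆ e∈K)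
    bypass : ∀ f → f ∈ᴱ K ∖ e → Walk (G ∖ e) (lo f) (hi f)
    bypass f f∈ with f≢e , f∈K ← ∈-∖⁻ K f∈ with K⊆ f∈K
    ... | inj₁ refl = detour e (e≢ij ∘ sym) (e≢jk ∘ sym)
    ... | inj₂ f∈G  = edge-walk (G ∖ e) f (∈-∖⁺ G f≢e f∈G)

  bridged-reduct₁ : Bridged G → Bridged (reduct₁ i<j j<k G)
  bridged-reduct₁ = bridged-reduct (reduct₁ i<j j<k G)
    (Sum.map₂ (proj₂ ∘ ∈-∖⁻ G) ∘ ∈-∪⁻ (G ∖ jk))
    (inj₂ λ jk∈ → [ jk≢ik , ∉-∖ G jk ]′ (∈-∪⁻ (G ∖ jk) jk∈))

  bridged-reduct₂ : Bridged G → Bridged (reduct₂ i<j j<k G)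
  bridged-reduct₂ = bridged-reduct (reduct₂ i<j j<k G)
    (Sum.map₂ (proj₂ ∘ ∈-∖⁻ G) ∘ ∈-∪⁻ (G ∖ ij))
    (inj₁ λ ij∈ → [ ij≢ik , ∉-∖ G ij ]′ (∈-∪⁻ (G ∖ ij) ij∈))

  bridged-reduct₃ : Bridged G → Bridged (reduct₃ i<j j<k G)
  bridged-reduct₃ = bridged-reduct (reduct₃ i<j j<k G)
    (Sum.map₂ (proj₂ ∘ ∈-∖⁻ G ∘ proj₂ ∘ ∈-∖⁻ (G ∖ ij)) ∘ ∈-∪⁻ (G ∖ ij ∖ jk))
    (inj₂ λ jk∈ → [ jk≢ik , ∉-∖ (G ∖ ij) jk ]′ (∈-∪⁻ (G ∖ ij ∖ jk) jk∈))

-- Simple paths, and the equivalence of the two forms of acyclicity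

Path : (Fin N → Fin N → Set) → Fin N → List (Fin N) → Fin N → Set
Path R u []       v = u ≡ v
Path R u (w ∷ vs) v = R u w × Path R w vs v

path-suffix : ∀ {R : Fin N → Fin N → Set} {u w v} vs → u ∈ w ∷ vs → Unique (w ∷ vs) → Path R w vs v →
              ∃[ us ] Unique (u ∷ us) × Path R u us v
path-suffix vs       (here refl) unique       path       = vs , unique , path
path-suffix (x ∷ vs) (there u∈)  (_ ∷ unique) (_ , path) = path-suffix vs u∈ unique path

-- Loop erasure: if `u` recurs on the simple path found for the rest, everything before that
-- occurrence is dropped.
simple-path : ∀ {R : Fin N → Fin N → Set} {u v} → Star R u v → ∃[ vs ] Unique (u ∷ vs) × Path R u vs v
simple-path ε = [] , ([] ∷ []) , refl
simple-path {u = u} (_◅_ {j = w} r rs) with simple-path rs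
... | vs , unique , path with DecMembership._∈?_ Fin._≟_ u (w ∷ vs)
...   | yes u∈ = path-suffix vs u∈ unique path
...   | no  u∉ = w ∷ vs , (All.¬Any⇒All¬ (w ∷ vs) u∉ ∷ unique) , r , path

path⇒linked : ∀ {R S : Fin N → Fin N → Set} → (∀ {u v} → R u v → S u v) →
              ∀ {u v x} vs → Path R u vs v → S v x → Linked S (u ∷ vs ∷ʳ x)
path⇒linked R⇒S []       refl       s = s ∷ [-]
path⇒linked R⇒S (w ∷ vs) (r , path) s = R⇒S r ∷ path⇒linked R⇒S vs path s

adjacent-∖⁻ : ∀ (G : Graph N) e {u v} → Adjacent (G ∖ e) u v → Adjacent G u v
adjacent-∖⁻ G e (inj₁ (p , f∈)) = inj₁ (p , proj₂ (∈-∖⁻ G f∈))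
adjacent-∖⁻ G e (inj₂ (p , f∈)) = inj₂ (p , proj₂ (∈-∖⁻ G f∈))

-- A simple path around `e` has at least two steps, since a single step would be the deleted edge
-- itself; `e` closes it to a cycle.
forest⇒bridged : ∀ (G : Graph N) → IsForest G → Bridged G
forest⇒bridged G forest e e∈G w with simple-path w
... | [] , _ , lo≡hi = Fin.<-irrefl lo≡hi (lo<hi e)
... | h ∷ [] , _ , inj₁ (_ , e∈) , refl = ∉-∖ G e e∈
... | h ∷ [] , _ , inj₂ (hi<lo , _) , refl = Fin.<-asym hi<lo (lo<hi e)
... | vs@(_ ∷ _ ∷ _) , unique , path = forest (lo e ∷ vs)
  ( s≤s (s≤s (s≤s z≤n)) , unique
  , path⇒linked (adjacent-∖⁻ G e) vs path (adjacent-sym G (adjacent G e e∈G)) )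

module _ (G : Graph N) (a v : Fin N) (e : Pair N)
         (joins : lo e ≡ v × hi e ≡ a ⊎ lo e ≡ a × hi e ≡ v) where

  adjacent-∖⁺ : ∀ {p q} → ¬ (p ≡ a × q ≡ v) → ¬ (p ≡ v × q ≡ a) → Adjacent G p q → Adjacent (G ∖ e) p q
  adjacent-∖⁺ ≢av ≢va (inj₁ (p , f∈)) = inj₁ (p , ∈-∖⁺ G
    (λ { refl → [ ≢va , ≢av ]′ joins }) f∈)
  adjacent-∖⁺ ≢av ≢va (inj₂ (p , f∈)) = inj₂ (p , ∈-∖⁺ G
    (λ { refl → [ (λ (q≡v , p≡a) → ≢av (p≡a , q≡v)) , (λ (q≡a , p≡v) → ≢va (p≡v , q≡a)) ]′ joins }) f∈)

  -- No step can use `e`, because none touches its end `a`.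
  avoiding-walk : a ≢ v → ∀ u us → All (a ≢_) (u ∷ us) → Linked (Adjacent G) (u ∷ us ∷ʳ v) → Walk (G ∖ e) u v
  avoiding-walk a≢v u []        (a≢u ∷ _)         (r ∷ _)      =
    adjacent-∖⁺ (λ (u≡a , _) → a≢u (sym u≡a)) (λ (_ , v≡a) → a≢v (sym v≡a)) r ◅ ε
  avoiding-walk a≢v u (u′ ∷ us) (a≢u ∷ a≢u′ ∷ a≢) (r ∷ linked) =
    adjacent-∖⁺ (λ (u≡a , _) → a≢u (sym u≡a)) (λ (_ , u′≡a) → a≢u′ (sym u′≡a)) r ◅
    avoiding-walk a≢v u′ us (a≢u′ ∷ a≢) linked

-- The first edge of a cycle is bypassed by the rest of the cycle.
bridged⇒forest : ∀ (G : Graph N) → Bridged G → IsForest G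
bridged⇒forest G bridged (v ∷ [])     (s≤s () , _)
bridged⇒forest G bridged (v ∷ a ∷ []) (s≤s (s≤s ()) , _)
bridged⇒forest G bridged (v ∷ a ∷ b ∷ us) (_ , (v≢a ∷ v≢b ∷ _) ∷ a≢ ∷ _ , va ∷ ab ∷ linked) =
  [ (λ (p , e∈) → bridged (pair v a p) e∈
      (walk-sym (G ∖ pair v a p) (back (pair v a p) (inj₁ (refl , refl)))))
  , (λ (p , e∈) → bridged (pair a v p) e∈ (back (pair a v p) (inj₂ (refl , refl))))
  ]′ va
  where
  back : ∀ e → lo e ≡ v × hi e ≡ a ⊎ lo e ≡ a × hi e ≡ v → Walk (G ∖ e) a v
  back e joins =
    -- This step starts at `a`, but it is not `e` because b differs from v.
    adjacent-∖⁺ G a v e joins (λ (_ , b≡v) → v≢b (sym b≡v)) (λ (a≡v , _) → v≢a (sym a≡v)) ab ◅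
    avoiding-walk G a v e joins (v≢a ∘ sym) b us a≢ linked

-- Counting leaves and monomials

count : (A → Bool) → List A → ℕ
count p []       = 0
count p (a ∷ as) = [ p a ] ℕ.+ count p as

count-cong : ∀ {p q : A → Bool} {as} → All (λ a → p a ≡ q a) as → count p as ≡ count q as
count-cong []         = refl
count-cong (eq ∷ eqs) = cong₂ (λ b n → [ b ] ℕ.+ n) eq (count-cong eqs)

length-filter-singleton : ∀ {P : A → Set} (P? : Decidable P) a → length (filter P? (a ∷ [])) ≡ [ does (P? a) ]
length-filter-singleton P? a with does (P? a)
... | true  = refl
... | false = refl

forest-leaf : ∀ {G : Graph N} k (irr : ¬ Reduction G) → IsForest G →
              forestLeafCount (leaf irr) k ≡ [ does (edgeCount G ℕ.≟ k) ]
forest-leaf {G = G} k irr forest = trans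
  (length-filter-singleton (λ H → forest? H ×-dec edgeCount H ℕ.≟ k) G)
  (cong [_] (does-⇔ (mk⇔ proj₂ (forest ,_)) (forest? G ×-dec edgeCount G ℕ.≟ k) (edgeCount G ℕ.≟ k)))

forestLeafCount-node : ∀ {G : Graph N} (r : Reduction G) T₁ T₂ T₃ k →
  forestLeafCount (node r T₁ T₂ T₃) k ≡
  forestLeafCount T₁ k ℕ.+ (forestLeafCount T₂ k ℕ.+ forestLeafCount T₃ k)
forestLeafCount-node r T₁ T₂ T₃ k = begin
  length (filter P? (leafLabels T₁ ++ leafLabels T₂ ++ leafLabels T₃))
    ≡⟨ length-filter-++ (leafLabels T₁) _ ⟩
  forestLeafCount T₁ k ℕ.+ length (filter P? (leafLabels T₂ ++ leafLabels T₃))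
    ≡⟨ cong (forestLeafCount T₁ k ℕ.+_) (length-filter-++ (leafLabels T₂) _) ⟩
  forestLeafCount T₁ k ℕ.+ (forestLeafCount T₂ k ℕ.+ forestLeafCount T₃ k) ∎
  where
  open ≡-Reasoning
  P? = λ H → forest? H ×-dec edgeCount H ℕ.≟ k
  length-filter-++ : ∀ Gs Hs → length (filter P? (Gs ++ Hs)) ≡ length (filter P? Gs) ℕ.+ length (filter P? Hs)
  length-filter-++ Gs Hs = trans (cong length (filter-++ P? Gs Hs)) (length-++ (filter P? Gs))

-- Induction on the tree. Reducts stay bridged, so every leaf is a forest and the edge `ik` is new
-- at every node.
forestLeafCount-weight : ∀ {G : Graph N} → Bridged G → ∀ (T : ReductionTree G) k →
                         ℤ.+ forestLeafCount T k ≡ weight k (edgeList G)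
forestLeafCount-weight {G = G} bridged (leaf irr) k = begin
  ℤ.+ forestLeafCount (leaf irr) k            ≡⟨ cong ℤ.+_ (forest-leaf k irr (bridged⇒forest G bridged)) ⟩
  ℤ.+ [ does (edgeCount G ℕ.≟ k) ]            ≡⟨ cong (λ d → ℤ.+ [ does (d ℕ.≟ k) ]) (length-edgeList G) ⟨
  ℤ.+ [ does (length (edgeList G) ℕ.≟ k) ]    ≡⟨ weight-alternating k (edgeList G)
                                                  (irreducible-graph⇒alternating G irr) ⟨
  weight k (edgeList G)                       ∎
  where open ≡-Reasoning
forestLeafCount-weight {G = G} bridged (node r T₁ T₂ T₃) w = begin
  ℤ.+ forestLeafCount (node r T₁ T₂ T₃) w
    ≡⟨ cong ℤ.+_ (forestLeafCount-node r T₁ T₂ T₃ w) ⟩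
  ℤ.+ forestLeafCount T₁ w + (ℤ.+ forestLeafCount T₂ w + ℤ.+ forestLeafCount T₃ w)
    ≡⟨ cong₂ _+_ (forestLeafCount-weight (bridged-reduct₁ G i<j j<k ij∈G jk∈G bridged) T₁ w)
        (cong₂ _+_ (forestLeafCount-weight (bridged-reduct₂ G i<j j<k ij∈G jk∈G bridged) T₂ w)
                   (forestLeafCount-weight (bridged-reduct₃ G i<j j<k ij∈G jk∈G bridged) T₃ w)) ⟩
  weight w (edgeList (reduct₁ i<j j<k G)) +
  (weight w (edgeList (reduct₂ i<j j<k G)) + weight w (edgeList (reduct₃ i<j j<k G)))
    ≡⟨ graph-weight-reduce r (bridged⇒ik∉ G i<j j<k ij∈G jk∈G bridged) w ⟨
  weight w (edgeList G) ∎
  where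
  open ≡-Reasoning
  open Reduction r

-- Weights and degrees along the reduction of polynomials

factors : Monomial N → List (Pair N)
factors m = edges (xExponents m)

factors-x· : ∀ {i j : Fin N} (i<j : i < j) m → factors (x i<j · m) ↭ pair i j i<j ∷ factors m
factors-x· i<j m = edges-unit-+ (pair _ _ i<j) (xExponents m)

factors-·-assoc : ∀ (a b c : Monomial N) → factors (a · b · c) ↭ factors (a · (b · c))
factors-·-assoc a b c =
  ↭-reflexive (cong edges (zipTable-assoc (xExponents a) (xExponents b) (xExponents c)))

factors-x·x· : ∀ {i j i′ j′ : Fin N} (i<j : i < j) (i<j′ : i′ < j′) m →
  factors (x i<j · x i<j′ · m) ↭ pair i j i<j ∷ pair i′ j′ i<j′ ∷ factors m
factors-x·x· i<j i<j′ m = ↭-trans (factors-·-assoc (x i<j) (x i<j′) m)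
  (↭-trans (factors-x· i<j (x i<j′ · m)) (↭.prep _ (factors-x· i<j′ m)))

factors-β·x· : ∀ {i j : Fin N} (i<j : i < j) m → factors (β^ 1 · x i<j · m) ↭ pair i j i<j ∷ factors m
factors-β·x· i<j m = ↭-trans (factors-·-assoc (β^ 1) (x i<j) m)
  (↭-trans (↭-reflexive (cong edges (zipTable-identityˡ (xExponents (x i<j · m))))) (factors-x· i<j m))

totalWeight : ℕ → Polynomial N → ℤ
totalWeight k []      = 0ℤ
totalWeight k (m ∷ P) = weight k (factors m) + totalWeight k P

totalWeight-≈ : ∀ k {P Q : Polynomial N} → P ≈ Q → totalWeight k P ≡ totalWeight k Q
totalWeight-≈ k ↭.refl            = refl
totalWeight-≈ k (↭.prep m p)      = cong (weight k (factors m) +_) (totalWeight-≈ k p)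
totalWeight-≈ k (↭.swap {xs} {ys} m n p) = trans
  (x∙yz≈y∙xz ℤ.+-commutativeSemigroup (weight k (factors m)) (weight k (factors n)) (totalWeight k xs))
  (cong (λ z → weight k (factors n) + (weight k (factors m) + z)) (totalWeight-≈ k p))
totalWeight-≈ k (↭.trans p q)     = trans (totalWeight-≈ k p) (totalWeight-≈ k q)

-- The weight ignores β, and the factors are kept with multiplicity, so the three new terms match
-- `weight-reduce`.
totalWeight-⟶ : ∀ k {P P′ : Polynomial N} → P ⟶ P′ → totalWeight k P ≡ totalWeight k P′
totalWeight-⟶ k {P} {P′} (rewrite-monomial {i} {j} {l} i<j j<l m Q P≈ P′≈) = begin
  totalWeight k P
    ≡⟨ totalWeight-≈ k P≈ ⟩
  weight k (factors (x i<j · x j<l · m)) + q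
    ≡⟨ cong (_+ q) (weight-↭ k (factors-x·x· i<j j<l m)) ⟩
  weight k (ij ∷ jl ∷ factors m) + q
    ≡⟨ cong (_+ q) (weight-reduce k i<j j<l (factors m)) ⟩
  weight k (il ∷ ij ∷ factors m) + (weight k (jl ∷ il ∷ factors m) + weight k (il ∷ factors m)) + q
    ≡⟨ cong (_+ q) (cong₂ _+_ (weight-↭ k (factors-x·x· i<l i<j m))
         (cong₂ _+_ (weight-↭ k (factors-x·x· j<l i<l m)) (weight-↭ k (factors-β·x· i<l m)))) ⟨
  a + (b + c) + q
    ≡⟨ trans (ℤ.+-assoc a (b + c) q) (cong (a +_) (ℤ.+-assoc b c q)) ⟩
  a + (b + (c + q))
    ≡⟨ totalWeight-≈ k P′≈ ⟨
  totalWeight k P′ ∎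
  where
  open ≡-Reasoning
  i<l = Fin.<-trans i<j j<l
  ij = pair i j i<j
  jl = pair j l j<l
  il = pair i l i<l
  q = totalWeight k Q
  a = weight k (factors (x i<l · x i<j · m))
  b = weight k (factors (x j<l · x i<l · m))
  c = weight k (factors (β^ 1 · x i<l · m))

totalWeight-⟶* : ∀ k {P P′ : Polynomial N} → Star _⟶_ P P′ → totalWeight k P ≡ totalWeight k P′
totalWeight-⟶* k ε        = refl
totalWeight-⟶* k (s ◅ ss) = trans (totalWeight-⟶ k s) (totalWeight-⟶* k ss)

totalWeight-reduced : ∀ k (P : Polynomial N) → All Irreducible P →
  totalWeight k P ≡ ℤ.+ count (λ m → does (length (factors m) ℕ.≟ k)) P
totalWeight-reduced k []      []         = refl
totalWeight-reduced k (m ∷ P) (irr ∷ irrs) = cong₂ _+_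
  (weight-alternating k (factors m) (irreducible⇒alternating m irr)) (totalWeight-reduced k P irrs)

-- The rule preserves the degree if β has degree 1. The remaining factor keeps the exponent of β
-- below `l`.
Homogeneous : ℕ → Monomial N → Set
Homogeneous l m = 1 ≤ length (factors m) × length (factors m) ℕ.+ βExponent m ≡ l

homogeneous-⟶ : ∀ {l} {P P′ : Polynomial N} → P ⟶ P′ → All (Homogeneous l) P → All (Homogeneous l) P′
homogeneous-⟶ {l = l} (rewrite-monomial {i} {j} {k} i<j j<k m Q P≈ P′≈) homs
  with (_ , deg) ∷ homs′ ← All-resp-↭ P≈ homs = All-resp-↭ (↭-sym P′≈)
    ( degree (factors-x·x· i<k i<j m) 2+
    ∷ degree (factors-x·x· j<k i<k m) 2+
    -- The lost factor is made up for by β.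
    ∷ degree (factors-β·x· i<k m) (trans (cong suc (ℕ.+-suc n (βExponent m))) 2+)
    ∷ homs′ )
  where
  i<k = Fin.<-trans i<j j<k
  n = length (factors m)

  2+ : suc (suc n) ℕ.+ βExponent m ≡ l
  2+ = trans (cong (ℕ._+ βExponent m) (sym (↭-length (factors-x·x· i<j j<k m)))) deg

  degree : ∀ {b e} {es fs : List (Pair _)} → es ↭ e ∷ fs → suc (length fs) ℕ.+ b ≡ l →
           1 ≤ length es × length es ℕ.+ b ≡ l
  degree {b} es↭ eq = subst (λ d → 1 ≤ d × d ℕ.+ b ≡ l) (sym (↭-length es↭)) (s≤s z≤n , eq)

homogeneous-⟶* : ∀ {l} {P P′ : Polynomial N} → Star _⟶_ P P′ → All (Homogeneous l) P → All (Homogeneous l) P′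
homogeneous-⟶* ε        homs = homs
homogeneous-⟶* (s ◅ ss) homs = homogeneous-⟶* ss (homogeneous-⟶ s homs)

∑<-cong : ∀ {p q : ℕ → Polynomial N} l → (∀ m → m ℕ.< l → p m ≡ q m) → ∑< l p ≡ ∑< l q
∑<-cong zero    p≗q = refl
∑<-cong (suc l) p≗q = cong₂ _++_ (p≗q 0 (s≤s z≤n)) (∑<-cong l λ m m<l → p≗q (suc m) (s≤s m<l))

∑<-insert : ∀ (g : ℕ → Monomial N) c l n → n ℕ.< l →
  ∑< l (λ m → ([ does (n ℕ.≟ m) ] ℕ.+ c m) ⊙ g m) ≈ g n ∷ ∑< l (λ m → c m ⊙ g m)
∑<-insert g c (suc l) zero    _         = ↭-refl
∑<-insert g c (suc l) (suc n) (s≤s n<l) = ↭-trans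
  (++⁺ˡ (c 0 ⊙ g 0) (∑<-insert (g ∘ suc) (c ∘ suc) l n n<l))
  (shift (g (suc n)) (c 0 ⊙ g 0) _)

∑<-empty : ∀ (g : ℕ → Monomial N) l → ∑< l (λ d → 0 ⊙ g d) ≡ []
∑<-empty g zero    = refl
∑<-empty g (suc l) = ∑<-empty (g ∘ suc) l

-- The terms are sorted by their exponent of β, each inserted into its own block of the sum.
collect : ∀ l (P : Polynomial N) → All (λ m → βExponent m ℕ.< l) P →
  P ∣x=1 ≈ ∑< l (λ d → count (λ m → does (βExponent m ℕ.≟ d)) P ⊙ β^ d)
collect l []      []         = ↭-reflexive (sym (∑<-empty β^ l))
collect l (m ∷ P) (d<l ∷ ds<l) = ↭-trans (↭.prep _ (collect l P ds<l)) (↭-sym (∑<-insert β^ _ l (βExponent m) d<l))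

-- Coefficients of reduced forms and the final statement

module _ {n : ℕ} (F : Graph (suc n)) {l : ℕ} (F-edges : edgeCount F ≡ l) (1≤l : 1 ≤ l) where

  -- By homogeneity the terms with β^m are those with l - m factors; as the monomials of `P` are
  -- alternating, the invariant total weight counts them.
  reduced-form : ∀ P → P IsReducedFormOf graphMonomial F →
                 P ∣x=1 ≈ ∑< l (λ m → ℤ.∣ weight (l ∸ m) (edgeList F) ∣ ⊙ β^ m)
  reduced-form P (steps , reduced) = ↭-trans
    (collect l P (All.map (λ {m} → β<l m) homs))
    (↭-reflexive (∑<-cong l λ d d<l → cong (_⊙ β^ d) (count≡weight d d<l)))
    where
    deg : length (edgeList F) ≡ l
    deg = trans (length-edgeList F) F-edges

    homs : All (Homogeneous l) P
    homs = homogeneous-⟶* steps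
      ((subst (1 ≤_) (sym deg) 1≤l , trans (ℕ.+-identityʳ _) deg) ∷ [])

    β<l : ∀ m → Homogeneous l m → βExponent m ℕ.< l
    β<l m (1≤d , eq) = ℕ.≤-trans (ℕ.+-monoˡ-≤ _ 1≤d) (ℕ.≤-reflexive eq)

    irreducible : All Irreducible P
    irreducible = All.tabulate λ m∈P i<j j<k → All.lookup (reduced i<j j<k) m∈P

    same-degree : ∀ d → d ℕ.< l → ∀ m → Homogeneous l m →
                  does (βExponent m ℕ.≟ d) ≡ does (length (factors m) ℕ.≟ l ∸ d)
    same-degree d d<l m (_ , eq) = does-⇔ (mk⇔ to from) (βExponent m ℕ.≟ d) (_ ℕ.≟ l ∸ d)
      where
      to : βExponent m ≡ d → length (factors m) ≡ l ∸ d
      to refl = sym (trans (cong (_∸ βExponent m) (sym eq)) (ℕ.m+n∸n≡m _ (βExponent m)))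
      from : length (factors m) ≡ l ∸ d → βExponent m ≡ d
      from eq′ = ℕ.+-cancelˡ-≡ (l ∸ d) _ _ (trans (cong (ℕ._+ βExponent m) (sym eq′))
        (trans eq (sym (ℕ.m∸n+n≡m (ℕ.<⇒≤ d<l)))))

    count≡weight : ∀ d → d ℕ.< l →
      count (λ m → does (βExponent m ℕ.≟ d)) P ≡ ℤ.∣ weight (l ∸ d) (edgeList F) ∣
    count≡weight d d<l = begin
      count (λ m → does (βExponent m ℕ.≟ d)) P
        ≡⟨ count-cong (All.map (λ {m} → same-degree d d<l m) homs) ⟩
      count (λ m → does (length (factors m) ℕ.≟ l ∸ d)) P
        ≡⟨ cong ℤ.∣_∣ (totalWeight-reduced (l ∸ d) P irreducible) ⟨
      ℤ.∣ totalWeight (l ∸ d) P ∣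
        ≡⟨ cong ℤ.∣_∣ (totalWeight-⟶* (l ∸ d) steps) ⟨
      ℤ.∣ weight (l ∸ d) (edgeList F) + 0ℤ ∣
        ≡⟨ cong ℤ.∣_∣ (ℤ.+-identityʳ (weight (l ∸ d) (edgeList F))) ⟩
      ℤ.∣ weight (l ∸ d) (edgeList F) ∣ ∎
      where open ≡-Reasoning

theorem10 : Σ[ f ∈ (∀ {n} → Graph (suc n) → ℕ → ℕ) ]
    (∀ n (F : Graph (suc n)) (l : ℕ) → IsForest F → edgeCount F ≡ l → 1 ≤ l →
    (∀ (T : ReductionTree F) k → forestLeafCount T k ≡ f F k) ×
    (∀ P → P IsReducedFormOf graphMonomial F →
    P ∣x=1 ≈ ∑< l (λ m → f F (l ∸ m) ⊙ β^ m)))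
-- The weight is an integer by construction; wherever it is compared with a number of leaves or of
-- monomials it equals that number, so `∣_∣` only changes its type.
theorem10 = (λ F k → ℤ.∣ weight k (edgeList F) ∣) , λ n F l forest F-edges 1≤l →
  (λ T k → cong ℤ.∣_∣ (forestLeafCount-weight (forest⇒bridged F forest) T k)) ,
  reduced-form F F-edges 1≤l
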